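{- Let $\Delta$ be a simplicial complex on a finite vertex set $V$, and let $\Delta^\vee=\{V\setminus F: F\subseteq V,\ F\notin\Delta\}$ be its Alexander dual (a simplicial complex on $V$). Then $\Delta$ satisfies the spectral recursion if and only if $\Delta^\vee$ satisfies the spectral recursion.
   Context: A simplicial complex $\Delta$ on a finite vertex set $V$ is a collection of subsets of $V$ (faces) closed under taking subsets. The empty set is a face (of dimension $-1$) of every complex that has at least one face; the empty complex $\emptyset$ (no faces at all) is allowed; an element $v\in V$ need not satisfy $\{v\}\in\Delta$. Put $\dim F=|F|-1$. A simplicial pair $(\Delta,\Delta')$ consists of two simplicial complexes on the same vertex set; pairs with the same set difference $\Delta\setminus\Delta'$ are identified, and a single complex $\Delta$ is the pair $(\Delta,\emptyset)$. For $i\ge -1$, $C_i(\Delta,\Delta';\mathbb R)$ is the real vector space of formal linear combinations of oriented $i$-dimensional faces $[F]$, $F\in\Delta\setminus\Delta'$, and $\partial_i\colon C_i\to C_{i-1}$ is the usual signed simplicial boundary operator with all terms outside $\Delta\setminus\Delta'$ dropped; $\partial_i^*$ is its adjoint (transposed matrix in the natural bases). The Laplacian is $L_i(\Delta,\Delta')=\partial_{i+1}\partial_{i+1}^*+\partial_i^*\partial_i$, and $\mathbf s_i(\Delta,\Delta')$ is the multiset of its eigenvalues (non-negative reals). The spectrum polynomial is the generating function $$S_{(\Delta,\Delta')}(t,q)=\sum_{i\ge 0}t^i\sum_{\lambda\in\mathbf s_{i-1}(\Delta,\Delta')}q^\lambda,\qquad S_\Delta=S_{(\Delta,\emptyset)}$$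 (exponents of $q$ may be arbitrary non-negative reals). For $e\in V$, the deletion $\Delta-e=\{F\in\Delta: e\notin F\}$ and the contraction $\Delta/e=\{F\setminus\{e\}: F\in\Delta,\ e\in F\}$ are simplicial complexes on vertex set $V\setminus\{e\}$. $\Delta$ satisfies the spectral recursion with respect to $e\in V$ if $$S_\Delta(t,q) = q\,S_{\Delta-e}(t,q) + qt\,S_{\Delta/e}(t,q) + (1-q)\,S_{(\Delta-e,\Delta/e)}(t,q),$$ and $\Delta$ satisfies the spectral recursion if this holds for every $e\in V$. -}

module Defs where

open import Algebra.Bundles using (CommutativeRing; Semiring)
import Algebra.Definitions.RawSemiring as RawSemiringDefinitions
import Algebra.Properties.Ring as RingProperties
import Algebra.Properties.Semiring.Sum as SemiringSum
open import Data.Bool.Base using (if_then_else_)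
open import Data.Bool.Properties as Bool using (not-involutive)
open import Data.Fin.Base using (Fin; zero; suc; punchIn)
open import Data.Fin.Properties using (any?)
open import Data.Fin.Subset using (Subset; inside; outside; _∈_; _⊆_; ∁; _-_; ∣_∣)
open import Data.Fin.Subset.Properties using (_∈?_; p⊆q⇒∁p⊇∁q; drop-there)
open import Data.Integer.Base as ℤ using (ℤ; +_; 0ℤ)
open import Data.List.Base as List using (List; []; _∷_; [_]; _++_; filter; length; lookup)
open import Data.Nat.Base as ℕ using (ℕ; zero; suc)
import Data.Nat.Properties as ℕ
open import Data.Product.Base using (∃; ∃-syntax; _×_; _,_; proj₁; proj₂)
import Data.Unit.Base as Unit
open import Data.Vec.Base as Vec using ([]; _∷_; insertAt; here; there)
import Data.Vec.Functional as Vector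
open import Data.Vec.Functional using (Vector)
open import Data.Vec.Functional.Properties using (insertAt-lookup; insertAt-punchIn)
open import Data.Vec.Properties using (≡-dec; map-∘; map-cong; map-id)
open import Level using (0ℓ)
open import Relation.Binary.Core using (Rel)
open import Relation.Binary.PropositionalEquality as ≡ using (_≡_)
open import Relation.Binary.Structures using (IsStrictTotalOrder)
open import Relation.Nullary using (Dec; yes; no; ¬_; does; map′; ¬?; _×-dec_; decidable-stable)
open import Relation.Unary using (Pred; Decidable; ∅)
import Relation.Binary.Reasoning.Setoid as SetoidReasoning

------------------------------------------------------------------------
-- The real numbers

-- The library has no real numbers.  They are axiomatised, as usual, as a
-- complete ordered field; the axioms determine the field up to unique
-- isomorphism.  The order is that of classical analysis: trichotomy, hence
-- equality, is decidable.

record RealNumbers : Set₁ where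
  infix 4 _<_
  field
    commutativeRing : CommutativeRing 0ℓ 0ℓ
  open CommutativeRing commutativeRing public
  field
    _<_                : Rel Carrier 0ℓ
    isStrictTotalOrder : IsStrictTotalOrder _≈_ _<_
    1≉0                : ¬ 1# ≈ 0#
    inverse            : ∀ x → ¬ x ≈ 0# → ∃[ y ] x * y ≈ 1#
    +-monoˡ-<          : ∀ {x y} z → x < y → x + z < y + z
    *-pos              : ∀ {x y} → 0# < x → 0# < y → 0# < x * y

  UpperBound : Pred Carrier 0ℓ → Pred Carrier 0ℓ
  UpperBound P u = ∀ {x} → P x → ¬ u < x

  field
    supremum : (P : Pred Carrier 0ℓ) → ∃ P → ∃ (UpperBound P) →
               ∃[ s ] UpperBound P s × (∀ {u} → UpperBound P u → ¬ u < s)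

  open IsStrictTotalOrder isStrictTotalOrder public using (_≟_)

------------------------------------------------------------------------
-- Simplicial complexes on the vertex set Fin n

-- A collection of subsets of a finite set is classically the same thing as
-- a decidable predicate on subsets.
record SimplicialComplex (n : ℕ) : Set₁ where
  field
    Face   : Pred (Subset n) 0ℓ
    Face?  : Decidable Face
    closed : ∀ {F G} → G ⊆ F → Face F → Face G

open SimplicialComplex public

-- No faces at all, not even the empty one.
emptyComplex : ∀ {n} → SimplicialComplex n
emptyComplex .Face       = ∅
emptyComplex .Face? _    = no λ ()
emptyComplex .closed _ ()

SimplicialPair : ℕ → Set₁
SimplicialPair n = SimplicialComplex n × SimplicialComplex n

insertAt-⊆ : ∀ {n} {F G : Subset n} e s → G ⊆ F → insertAt G e s ⊆ insertAt F e s
insertAt-⊆ zero s G⊆F here        = here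
insertAt-⊆ zero s G⊆F (there x∈)  = there (G⊆F x∈)
insertAt-⊆ {F = _ ∷ _} {G = _ ∷ _} (suc e) s G⊆F here with here ← G⊆F here = here
insertAt-⊆ {F = _ ∷ _} {G = _ ∷ _} (suc e) s G⊆F (there x∈) =
  there (insertAt-⊆ e s (λ y∈ → drop-there (G⊆F (there y∈))) x∈)

-- V ∖ {e} is relabelled as Fin n by the order-preserving bijection
-- punchIn e.  Under it, a subset F of V ∖ {e} is, as a subset of V,
-- insertAt F e outside, and F ∪ {e} is insertAt F e inside.

deletion : ∀ {n} → SimplicialComplex (suc n) → Fin (suc n) → SimplicialComplex n
deletion Δ e .Face F         = Face Δ (insertAt F e outside)
deletion Δ e .Face? F        = Face? Δ (insertAt F e outside)
deletion Δ e .closed G⊆F     = closed Δ (insertAt-⊆ e outside G⊆F)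

contraction : ∀ {n} → SimplicialComplex (suc n) → Fin (suc n) → SimplicialComplex n
contraction Δ e .Face F      = Face Δ (insertAt F e inside)
contraction Δ e .Face? F     = Face? Δ (insertAt F e inside)
contraction Δ e .closed G⊆F  = closed Δ (insertAt-⊆ e inside G⊆F)

∁-involutive : ∀ {n} (F : Subset n) → ∁ (∁ F) ≡ F
∁-involutive F =
  ≡.trans (≡.sym (map-∘ _ _ F)) (≡.trans (map-cong not-involutive F) (map-id F))

infix 8 _^∨

_^∨ : ∀ {n} → SimplicialComplex n → SimplicialComplex n
(Δ ^∨) .Face G = ∃[ F ] ¬ Face Δ F × G ≡ ∁ F
(Δ ^∨) .Face? G =
  map′ (λ ∁G∉Δ → ∁ G , ∁G∉Δ , ≡.sym (∁-involutive G))
       (λ { (F , F∉Δ , ≡.refl) → ≡.subst (λ H → ¬ Face Δ H) (≡.sym (∁-involutive F)) F∉Δ })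
       (¬? (Face? Δ (∁ G)))
(Δ ^∨) .closed {G = G} G⊆∁F (F , F∉Δ , ≡.refl) =
  ∁ G , (λ ∁G∈Δ → F∉Δ (closed Δ F⊆∁G ∁G∈Δ)) , ≡.sym (∁-involutive G)
  where
  F⊆∁G : F ⊆ ∁ G
  F⊆∁G x∈F = p⊆q⇒∁p⊇∁q {p = G} {q = ∁ F} G⊆∁F (≡.subst (_ ∈_) (≡.sym (∁-involutive F)) x∈F)

subsets : ∀ n → List (Subset n)
subsets zero    = [ [] ]
subsets (suc n) = List.map (outside ∷_) (subsets n) ++ List.map (inside ∷_) (subsets n)

-- Throughout, chains are graded by cardinality: C_{k-1} has degree k.
faces : ∀ {n} → SimplicialPair n → ℕ → List (Subset n)
faces (Δ , Δ′) k =
  filter (λ F → (∣ F ∣ ℕ.≟ k) ×-dec (Face? Δ F ×-dec ¬? (Face? Δ′ F))) (subsets _)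

-- The number of elements of F that are smaller than v.
position : ∀ {n} → Fin n → Subset n → ℕ
position zero    _             = 0
position (suc v) (inside  ∷ F) = suc (position v F)
position (suc v) (outside ∷ F) = position v F

infix 4 _≟ₛ_

_≟ₛ_ : ∀ {n} (F G : Subset n) → Dec (F ≡ G)
_≟ₛ_ = ≡-dec Bool._≟_

module Spectral (ℝ : RealNumbers) where

  open RealNumbers ℝ hiding (zero; _-_)
  open RawSemiringDefinitions (Semiring.rawSemiring semiring) using (_^_)
  open SemiringSum semiring
    using (sum; sum-syntax; sum-cong-≋; sum-remove; ∑-distrib-+; ∑-comm;
           *-distribˡ-sum; *-distribʳ-sum; sum-replicate-zero)
  open RingProperties ring using (-‿distribˡ-*; -‿distribʳ-*; +-inverseˡ-unique)
  open SetoidReasoning setoid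

  ----------------------------------------------------------------------
  -- Matrices and eigenspaces

  Matrix : ℕ → ℕ → Set
  Matrix m n = Vector (Vector Carrier n) m

  infixl 6 _+ᴹ_
  infixl 7 _*ᴹ_
  infix  8 _ᵀ

  0ᴹ : ∀ {m n} → Matrix m n
  0ᴹ _ _ = 0#

  _+ᴹ_ : ∀ {m n} → Matrix m n → Matrix m n → Matrix m n
  (A +ᴹ B) i j = A i j + B i j

  _*ᴹ_ : ∀ {l m n} → Matrix l m → Matrix m n → Matrix l n
  _*ᴹ_ {m = m} A B i k = ∑[ j < m ] (A i j * B j k)

  _ᵀ : ∀ {m n} → Matrix m n → Matrix n m
  _ᵀ = Vector.transpose

  Eigenspace : ∀ {n} → Matrix n n → Carrier → Pred (Vector Carrier n) 0ℓ
  Eigenspace {n} A x v = ∀ i → ∑[ j < n ] (A i j * v j) ≈ x * v i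

  record Basis {n} (W : Pred (Vector Carrier n) 0ℓ) (d : ℕ) : Set where
    field
      vectors     : Vector (Vector Carrier n) d
      contained   : ∀ j → W (vectors j)
      independent : ∀ (c : Vector Carrier d) →
                    (∀ i → ∑[ j < d ] (c j * vectors j i) ≈ 0#) → ∀ j → c j ≈ 0#
      spanning    : ∀ {v} → W v →
                    ∃ λ (c : Vector Carrier d) → ∀ i → v i ≈ ∑[ j < d ] (c j * vectors j i)

  -- Gaussian elimination: the solution space of a finite system of
  -- homogeneous linear equations has a finite basis.
  module LinearSystems where
    infix 7 _∙_
    _∙_ : ∀ {n} → Vector Carrier n → Vector Carrier n → Carrier
    _∙_ {n} a v = ∑[ i < n ] (a i * v i)

    Kernel : ∀ {m n} → Matrix m n → Pred (Vector Carrier n) 0ℓ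
    Kernel A v = ∀ i → A i ∙ v ≈ 0#

    ∙-linear : ∀ {n} (a x y : Vector Carrier n) c →
               a ∙ (λ i → x i + c * y i) ≈ a ∙ x + c * (a ∙ y)
    ∙-linear {n} a x y c = begin
      ∑[ i < n ] (a i * (x i + c * y i))                ≈⟨ sum-cong-≋ {n} (λ i → trans (distribˡ _ _ _) (+-congˡ (swap i))) ⟩
      ∑[ i < n ] (a i * x i + c * (a i * y i))          ≈⟨ ∑-distrib-+ {n} (λ i → a i * x i) _ ⟩
      a ∙ x + ∑[ i < n ] (c * (a i * y i))              ≈⟨ +-congˡ (*-distribˡ-sum {n} c (λ i → a i * y i)) ⟨
      a ∙ x + c * (a ∙ y)                               ∎
      where
      swap : ∀ i → a i * (c * y i) ≈ c * (a i * y i)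
      swap i = trans (sym (*-assoc _ _ _)) (trans (*-congʳ (*-comm _ _)) (*-assoc _ _ _))

    ∙-sum : ∀ {n d} (a : Vector Carrier n) (k : Vector Carrier d) (b : Vector (Vector Carrier n) d) →
            a ∙ (λ i → ∑[ j < d ] (k j * b j i)) ≈ ∑[ j < d ] (k j * (a ∙ b j))
    ∙-sum {n} {d} a k b = begin
      ∑[ i < n ] (a i * ∑[ j < d ] (k j * b j i))       ≈⟨ sum-cong-≋ {n} (λ i → *-distribˡ-sum (a i) (λ j → k j * b j i)) ⟩
      ∑[ i < n ] ∑[ j < d ] (a i * (k j * b j i))       ≈⟨ ∑-comm {n} {d} _ ⟩
      ∑[ j < d ] ∑[ i < n ] (a i * (k j * b j i))       ≈⟨ sum-cong-≋ {d} (λ j → sum-cong-≋ {n} (λ i → swap i j)) ⟩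
      ∑[ j < d ] ∑[ i < n ] (k j * (a i * b j i))       ≈⟨ sum-cong-≋ {d} (λ j → *-distribˡ-sum (k j) (λ i → a i * b j i)) ⟨
      ∑[ j < d ] (k j * (a ∙ b j))                      ∎
      where
      swap : ∀ i j → a i * (k j * b j i) ≈ k j * (a i * b j i)
      swap i j = trans (sym (*-assoc _ _ _)) (trans (*-congʳ (*-comm _ _)) (*-assoc _ _ _))

    δ : ∀ {n} → Fin n → Fin n → Carrier
    δ zero    zero    = 1#
    δ zero    (suc _) = 0#
    δ (suc _) zero    = 0#
    δ (suc i) (suc j) = δ i j

    sum-zero : ∀ {n} (f : Vector Carrier n) → (∀ i → f i ≈ 0#) → sum f ≈ 0#
    sum-zero {n} f f≈0 = trans (sum-cong-≋ {n} f≈0) (sum-replicate-zero n)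

    sum-δ : ∀ {n} (v : Vector Carrier n) i → ∑[ j < n ] (v j * δ j i) ≈ v i
    sum-δ v zero    = trans (+-cong (*-identityʳ _) (sum-zero (λ j → v (suc j) * 0#) (λ _ → zeroʳ _))) (+-identityʳ _)
    sum-δ v (suc i) = trans (+-cong (zeroʳ _) (sum-δ (Vector.tail v) i)) (+-identityˡ _)

    module Eliminate {m n d} (A : Matrix (suc m) n) (B : Basis (Kernel (Vector.tail A)) (suc d))
                     (p : Fin (suc d)) (Ab≉0 : ¬ A zero ∙ Basis.vectors B p ≈ 0#) where

      open Basis B

      a : Vector Carrier n
      a = A zero

      q : Carrier
      q = proj₁ (inverse _ Ab≉0)

      q-inverse : (a ∙ vectors p) * q ≈ 1#
      q-inverse = proj₂ (inverse _ Ab≉0)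

      rest : Vector (Vector Carrier n) d
      rest j = vectors (punchIn p j)

      r : Vector Carrier d
      r j = - ((a ∙ rest j) * q)

      new : Vector (Vector Carrier n) d
      new j i = rest j i + r j * vectors p i

      new-sum : ∀ (k : Vector Carrier d) i →
                ∑[ j < d ] (k j * new j i) ≈
                ∑[ j < d ] (k j * r j) * vectors p i + ∑[ j < d ] (k j * rest j i)
      new-sum k i = begin
        ∑[ j < d ] (k j * (rest j i + r j * vectors p i))
          ≈⟨ sum-cong-≋ {d} (λ j → trans (distribˡ _ _ _) (trans (+-comm _ _) (+-congʳ (sym (*-assoc _ _ _))))) ⟩
        ∑[ j < d ] (k j * r j * vectors p i + k j * rest j i)
          ≈⟨ ∑-distrib-+ (λ j → k j * r j * vectors p i) _ ⟩
        ∑[ j < d ] (k j * r j * vectors p i) + ∑[ j < d ] (k j * rest j i)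
          ≈⟨ +-congʳ (*-distribʳ-sum (vectors p i) (λ j → k j * r j)) ⟨
        ∑[ j < d ] (k j * r j) * vectors p i + ∑[ j < d ] (k j * rest j i) ∎

      new-contained : ∀ j → Kernel A (new j)
      new-contained j zero = begin
        a ∙ new j                                                ≈⟨ ∙-linear a (rest j) (vectors p) (r j) ⟩
        a ∙ rest j + - ((a ∙ rest j) * q) * (a ∙ vectors p)      ≈⟨ +-congˡ (-‿distribˡ-* _ _) ⟨
        a ∙ rest j + - (((a ∙ rest j) * q) * (a ∙ vectors p))    ≈⟨ +-congˡ (-‿cong (trans (*-assoc _ _ _) (*-congˡ (trans (*-comm _ _) q-inverse)))) ⟩
        a ∙ rest j + - ((a ∙ rest j) * 1#)                       ≈⟨ +-congˡ (-‿cong (*-identityʳ _)) ⟩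
        a ∙ rest j + - (a ∙ rest j)                              ≈⟨ -‿inverseʳ _ ⟩
        0#                                                       ∎
      new-contained j (suc i) = begin
        A (suc i) ∙ new j                                        ≈⟨ ∙-linear (A (suc i)) (rest j) (vectors p) (r j) ⟩
        A (suc i) ∙ rest j + r j * (A (suc i) ∙ vectors p)       ≈⟨ +-cong (contained (punchIn p j) i) (*-congˡ (contained p i)) ⟩
        0# + r j * 0#                                            ≈⟨ trans (+-identityˡ _) (zeroʳ _) ⟩
        0#                                                       ∎

      new-independent : ∀ (k : Vector Carrier d) →
                        (∀ i → ∑[ j < d ] (k j * new j i) ≈ 0#) → ∀ j → k j ≈ 0#
      new-independent k eq j =
        trans (reflexive (≡.sym (insertAt-punchIn k p s j))) (independent k′ eq′ (punchIn p j))
        where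
        s = ∑[ j < d ] (k j * r j)
        k′ = Vector.insertAt k p s
        eq′ : ∀ i → ∑[ j < suc d ] (k′ j * vectors j i) ≈ 0#
        eq′ i = begin
          ∑[ j < suc d ] (k′ j * vectors j i)                             ≈⟨ sum-remove {i = p} (λ j → k′ j * vectors j i) ⟩
          k′ p * vectors p i + ∑[ j < d ] (k′ (punchIn p j) * rest j i)   ≈⟨ +-cong (*-congʳ (reflexive (insertAt-lookup k p s)))
                                                                               (sum-cong-≋ {d} (λ j → *-congʳ (reflexive (insertAt-punchIn k p s j)))) ⟩
          s * vectors p i + ∑[ j < d ] (k j * rest j i)                   ≈⟨ new-sum k i ⟨
          ∑[ j < d ] (k j * new j i)                                      ≈⟨ eq i ⟩
          0#                                                              ∎

      new-spanning : ∀ {v} → Kernel A v → ∃ λ (c : Vector Carrier d) → ∀ i → v i ≈ ∑[ j < d ] (c j * new j i)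
      new-spanning {v} v∈K with spanning (λ i → v∈K (suc i))
      ... | c , v≈ = k , λ i → begin
        v i                                                               ≈⟨ v≈ i ⟩
        ∑[ j < suc d ] (c j * vectors j i)                                ≈⟨ sum-remove {i = p} (λ j → c j * vectors j i) ⟩
        c p * vectors p i + ∑[ j < d ] (k j * rest j i)                   ≈⟨ +-congʳ (*-congʳ cp≈) ⟩
        ∑[ j < d ] (k j * r j) * vectors p i + ∑[ j < d ] (k j * rest j i) ≈⟨ new-sum k i ⟨
        ∑[ j < d ] (k j * new j i)                                        ∎
        where
        k : Vector Carrier d
        k j = c (punchIn p j)

        t : Carrier
        t = ∑[ j < d ] (k j * (a ∙ rest j))

        relation : c p * (a ∙ vectors p) + t ≈ 0#
        relation = begin
          c p * (a ∙ vectors p) + t                       ≈⟨ sum-remove {i = p} (λ j → c j * (a ∙ vectors j)) ⟨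
          ∑[ j < suc d ] (c j * (a ∙ vectors j))          ≈⟨ ∙-sum a c vectors ⟨
          a ∙ (λ i → ∑[ j < suc d ] (c j * vectors j i))  ≈⟨ sum-cong-≋ {n} (λ i → *-congˡ (v≈ i)) ⟨
          a ∙ v                                           ≈⟨ v∈K zero ⟩
          0#                                              ∎

        cp≈ : c p ≈ ∑[ j < d ] (k j * r j)
        cp≈ = begin
          c p                                             ≈⟨ *-identityʳ _ ⟨
          c p * 1#                                        ≈⟨ *-congˡ q-inverse ⟨
          c p * ((a ∙ vectors p) * q)                     ≈⟨ *-assoc _ _ _ ⟨
          c p * (a ∙ vectors p) * q                       ≈⟨ *-congʳ (+-inverseˡ-unique _ _ relation) ⟩
          - t * q                                         ≈⟨ trans (sym (-‿distribˡ-* _ _)) (-‿distribʳ-* _ _) ⟩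
          t * - q                                         ≈⟨ *-distribʳ-sum (- q) (λ j → k j * (a ∙ rest j)) ⟩
          ∑[ j < d ] (k j * (a ∙ rest j) * - q)           ≈⟨ sum-cong-≋ {d} (λ j → trans (*-assoc _ _ _) (*-congˡ (sym (-‿distribʳ-* _ _)))) ⟩
          ∑[ j < d ] (k j * r j)                          ∎

      basis : Basis (Kernel A) d
      basis = record
        { vectors = new ; contained = new-contained
        ; independent = new-independent ; spanning = new-spanning }

    kernelBasis : ∀ {m n} (A : Matrix m n) → ∃ (Basis (Kernel A))
    kernelBasis {zero} {n} A = n , record
      { vectors     = δ
      ; contained   = λ _ ()
      ; independent = λ c eq i → trans (sym (sum-δ c i)) (eq i)
      ; spanning    = λ {v} _ → v , λ i → sym (sum-δ v i) }
    kernelBasis {suc m} A with kernelBasis (Vector.tail A)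
    ... | d , B with any? (λ j → ¬? ((A zero ∙ Basis.vectors B j) ≟ 0#))
    kernelBasis {suc m} A | suc d , B | yes (p , Ab≉0) = d , Eliminate.basis A B p Ab≉0
    kernelBasis {suc m} A | d , B | no ∄ = d , record
      { vectors     = vectors
      ; contained   = λ { j zero    → decidable-stable (_ ≟ _) (λ Ab≉0 → ∄ (j , Ab≉0))
                        ; j (suc i) → contained j i }
      ; independent = independent
      ; spanning    = λ v∈K → spanning (λ i → v∈K (suc i)) }
      where open Basis B

    shifted : ∀ {n} → Matrix n n → Carrier → Matrix n n
    shifted A x i j = A i j + - x * δ j i

    shifted-∙ : ∀ {n} (A : Matrix n n) x v i → shifted A x i ∙ v ≈ A i ∙ v + - (x * v i)
    shifted-∙ {n} A x v i = begin
      ∑[ j < n ] ((A i j + - x * δ j i) * v j)           ≈⟨ sum-cong-≋ {n} (λ j → trans (distribʳ _ _ _) (+-congˡ (swap j))) ⟩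
      ∑[ j < n ] (A i j * v j + - x * (v j * δ j i))     ≈⟨ ∑-distrib-+ {n} (λ j → A i j * v j) _ ⟩
      A i ∙ v + ∑[ j < n ] (- x * (v j * δ j i))         ≈⟨ +-congˡ (*-distribˡ-sum (- x) (λ j → v j * δ j i)) ⟨
      A i ∙ v + - x * ∑[ j < n ] (v j * δ j i)           ≈⟨ +-congˡ (*-congˡ (sum-δ v i)) ⟩
      A i ∙ v + - x * v i                                ≈⟨ +-congˡ (-‿distribˡ-* _ _) ⟨
      A i ∙ v + - (x * v i)                              ∎
      where
      swap : ∀ j → - x * δ j i * v j ≈ - x * (v j * δ j i)
      swap j = trans (*-assoc _ _ _) (*-congˡ (*-comm _ _))

  open LinearSystems

  eigenspaceBasis : ∀ {n} (A : Matrix n n) x → ∃ (Basis (Eigenspace A x))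
  eigenspaceBasis A x with kernelBasis (shifted A x)
  ... | d , B = d , record
    { vectors     = vectors
    ; contained   = λ j i → x-y≈0⇒x≈y (trans (sym (shifted-∙ A x (vectors j) i)) (contained j i))
    ; independent = independent
    ; spanning    = λ {v} v∈E → spanning (λ i → trans (shifted-∙ A x v i) (trans (+-congʳ (v∈E i)) (-‿inverseʳ _))) }
    where
    open Basis B
    x-y≈0⇒x≈y : ∀ {y z} → y + - z ≈ 0# → y ≈ z
    x-y≈0⇒x≈y {y} {z} eq = begin
      y                ≈⟨ +-identityʳ y ⟨
      y + 0#           ≈⟨ +-congˡ (-‿inverseˡ z) ⟨
      y + (- z + z)    ≈⟨ +-assoc _ _ _ ⟨
      y + - z + z      ≈⟨ +-congʳ eq ⟩
      0# + z           ≈⟨ +-identityˡ z ⟩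
      z                ∎

  -- The multiset of eigenvalues of a symmetric real matrix A is given by its
  -- multiplicity function: x occurs as often as the dimension of its
  -- eigenspace, so not at all unless x is an eigenvalue.  For symmetric A this
  -- is also the multiplicity as a root of the characteristic polynomial.
  multiplicity : ∀ {n} → Matrix n n → Carrier → ℕ
  multiplicity A x = proj₁ (eigenspaceBasis A x)

  ----------------------------------------------------------------------
  -- Laplacians

  -- The coefficient of [G] in ∂[F] = Σ_{v ∈ F} (-1)^{position v F} [F ∖ {v}],
  -- faces being oriented by the order of Fin n.
  incidence : ∀ {n} → Subset n → Subset n → Carrier
  incidence {n} G F =
    ∑[ v < n ] (if does ((v ∈? F) ×-dec (G ≟ₛ F - v)) then (- 1#) ^ position v F else 0#)

  -- ∂ P k maps degree suc k to degree k, i.e. it is ∂_k : C_k → C_{k-1}.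
  ∂ : ∀ {n} (P : SimplicialPair n) k → Matrix (length (faces P k)) (length (faces P (suc k)))
  ∂ P k i j = incidence (lookup (faces P k) i) (lookup (faces P (suc k)) j)

  -- There are no chains below degree 0, so ∂_{-1} = 0.
  downLaplacian : ∀ {n} (P : SimplicialPair n) k → Matrix (length (faces P k)) (length (faces P k))
  downLaplacian P zero    = 0ᴹ
  downLaplacian P (suc k) = ∂ P k ᵀ *ᴹ ∂ P k

  -- L_{k-1}
  laplacian : ∀ {n} (P : SimplicialPair n) k → Matrix (length (faces P k)) (length (faces P k))
  laplacian P k = ∂ P k *ᴹ ∂ P k ᵀ +ᴹ downLaplacian P k

  ----------------------------------------------------------------------
  -- Generating functions in t and q, q having real exponents

  -- f k x is the coefficient of t^k q^x.
  GeneratingFunction : Set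
  GeneratingFunction = ℕ → Carrier → ℤ

  infix  4 _≐_
  infixl 6 _⊕_ _⊖_
  infixr 7 q·_ t·_

  _≐_ : GeneratingFunction → GeneratingFunction → Set
  f ≐ g = ∀ k x → f k x ≡ g k x

  _⊕_ _⊖_ : GeneratingFunction → GeneratingFunction → GeneratingFunction
  (f ⊕ g) k x = f k x ℤ.+ g k x
  (f ⊖ g) k x = f k x ℤ.- g k x

  q·_ t·_ : GeneratingFunction → GeneratingFunction
  (q· f) k x = f k (x + - 1#)
  (t· f) zero    x = 0ℤ
  (t· f) (suc k) x = f k x

  -- In Σ_k t^k Σ_{λ ∈ s_{k-1}} q^λ the coefficient of t^k q^x is the
  -- multiplicity of x in s_{k-1}.
  spectrumPolynomial : ∀ {n} → SimplicialPair n → GeneratingFunction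
  spectrumPolynomial P k x = + multiplicity (laplacian P k) x

  S : ∀ {n} → SimplicialComplex n → GeneratingFunction
  S Δ = spectrumPolynomial (Δ , emptyComplex)

  SpectralRecursionAt : ∀ {n} → SimplicialComplex (suc n) → Fin (suc n) → Set
  SpectralRecursionAt Δ e =
    S Δ ≐ q· S (deletion Δ e) ⊕ q· t· S (contraction Δ e) ⊕ (S′ ⊖ q· S′)
    where
    S′ = spectrumPolynomial (deletion Δ e , contraction Δ e)

  SatisfiesSpectralRecursion : ∀ {n} → SimplicialComplex n → Set
  SatisfiesSpectralRecursion {zero}  Δ = Unit.⊤
  SatisfiesSpectralRecursion {suc n} Δ = ∀ e → SpectralRecursionAt Δ e

{-# OPTIONS --safe #-}

-- Let d be the boundary matrix of the full simplex on the n vertices, so that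
-- d dᵀ + dᵀ d = n.  Splitting the subsets of V into the faces and the
-- non-faces of Δ, and writing B for the block of d that maps non-faces with
-- one more element to the k-element faces, this identity reads
-- L(Δ) + B Bᵀ = n on the faces and L(2^V , Δ) + Bᵀ B = n on the non-faces.
-- As B Bᵀ and Bᵀ B have the same nonzero eigenvalues, the spectra of Δ and of
-- (2^V , Δ) agree, up to a shift of the degree, away from the eigenvalue n,
-- where the multiplicities differ by the difference of the sizes.
-- Complementation of subsets turns d into its transpose up to signs, hence
-- (2^V , Δ) into Δ^∨ and (Δ - e , Δ / e) into (Δ^∨ - e , Δ^∨ / e), while
-- Δ^∨ - e is dual to Δ / e and Δ^∨ / e to Δ - e.  So the recursion for Δ^∨ is
-- the recursion for Δ in complementary degree; at the eigenvalue n the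
-- correction terms cancel because face numbers are additive under deletion
-- and contraction.

module Submission where

open import Defs
open import Algebra.Bundles using (CommutativeMonoid; Semiring)
import Algebra.Definitions.RawSemiring as RawSemiringDefinitions
import Algebra.Properties.AbelianGroup as AbelianGroupProperties
import Algebra.Properties.CommutativeSemigroup as CommutativeSemigroupProperties
import Algebra.Properties.Ring as RingProperties
import Algebra.Properties.Semiring.Sum as SemiringSum
open import Data.Bool.Base using (Bool; true; false; if_then_else_; _∧_)
open import Data.Bool.Properties using (∧-zeroʳ)
open import Data.Fin.Base using (Fin; zero; suc; _↑ˡ_; _↑ʳ_; splitAt)
open import Data.Fin.Properties using (any?; splitAt⁻¹-↑ˡ; splitAt⁻¹-↑ʳ)
open import Data.Fin.Subset using (Subset; inside; outside; _⊆_; ∁; _-_; ∣_∣)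
open import Data.Fin.Subset.Properties using (_∈?_; p─⊥≡p; ⊆-refl; s⊆s; out⊆; ∣∁p∣≡n∸∣p∣; ∣p∣≤n)
open import Data.Integer.Base as ℤ using (ℤ; +_; 0ℤ; 1ℤ)
import Data.Integer.Properties as ℤ
open import Data.Integer.Tactic.RingSolver using (solve-∀)
open import Data.List.Base as List using (List; []; _∷_; _++_; filter; length; lookup)
open import Data.List.Membership.Propositional.Properties using (∈-lookup; ∈-map⁻)
open import Data.List.Properties using (filter-++; length-++; filter-≐; filter-none)
open import Data.List.Relation.Binary.Disjoint.Propositional using (Disjoint)
open import Data.List.Relation.Unary.All as All using ()
open import Data.List.Relation.Unary.All.Properties using (all-filter)
open import Data.List.Relation.Unary.AllPairs using ([]; _∷_)
open import Data.List.Relation.Unary.Unique.Propositional using (Unique)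
import Data.List.Relation.Unary.Unique.Propositional.Properties as Unique
open import Data.Nat.Base as ℕ using (ℕ; zero; suc)
import Data.Nat.Properties as ℕ
open import Data.Product.Base using (∃; _×_; _,_; proj₁; proj₂)
open import Data.Sum.Base as Sum using (_⊎_; inj₁; inj₂)
open import Data.Vec.Base using ([]; _∷_; insertAt)
import Data.Vec.Functional as Vector
open import Data.Vec.Functional using (Vector)
open import Data.Vec.Functional.Properties using (lookup-++ˡ; lookup-++ʳ)
open import Data.Vec.Properties using (∷-injectiveʳ; map-insertAt)
open import Function.Base using (_∘_)
open import Function.Bundles using (_⇔_; mk⇔)
open import Level using (0ℓ)
open import Relation.Binary.Definitions using (tri<; tri≈; tri>)
open import Relation.Binary.PropositionalEquality as ≡ using (_≡_)
import Relation.Binary.Reasoning.Setoid as SetoidReasoning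
open import Relation.Binary.Structures using (IsStrictTotalOrder)
open import Relation.Nullary using (Dec; yes; no; ¬_; ¬?; does; contradiction; _×-dec_; decidable-stable)
open import Relation.Nullary.Decidable using (dec-true; dec-false; toSum)
open import Relation.Unary using (Pred; Decidable; _≐_)

-- Eigenspaces of real matrices and their dimensions.

module LinearAlgebra (ℝ : RealNumbers) where
  open RealNumbers ℝ hiding (zero; _-_)
  open Spectral ℝ
  open LinearSystems
  open SemiringSum semiring using (sum; sum-syntax; sum-cong-≋; *-distribˡ-sum)
  open RingProperties ring using (-‿distribˡ-*; -‿distribʳ-*)
  open AbelianGroupProperties +-abelianGroup using (⁻¹-involutive; x∙y⁻¹≈ε⇒x≈y) renaming (∙-cancelˡ to +-cancelˡ; ∙-cancelʳ to +-cancelʳ)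
  open IsStrictTotalOrder isStrictTotalOrder using (compare; <-resp-≈; irrefl) renaming (trans to <-trans)
  private module *-CS = CommutativeSemigroupProperties *-commutativeSemigroup
  open SetoidReasoning setoid

  private variable
    d d′ m n : ℕ

  infix 4 _≋_
  _≋_ : Vector Carrier n → Vector Carrier n → Set
  v ≋ w = ∀ i → v i ≈ w i

  0ⱽ : Vector Carrier n
  0ⱽ _ = 0#

  infix 7 _·_
  _·_ : Matrix m n → Vector Carrier n → Vector Carrier m
  (A · v) i = A i ∙ v

  ∙-cong : {a b v w : Vector Carrier n} → a ≋ b → v ≋ w → a ∙ v ≈ b ∙ w
  ∙-cong {n} a≋b v≋w = sum-cong-≋ {n} (λ i → *-cong (a≋b i) (v≋w i))

  ∙-congˡ : (a : Vector Carrier n) {v w : Vector Carrier n} → v ≋ w → a ∙ v ≈ a ∙ w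
  ∙-congˡ a = ∙-cong {a = a} (λ _ → refl)

  ∙-comm : (a v : Vector Carrier n) → a ∙ v ≈ v ∙ a
  ∙-comm {n} a v = sum-cong-≋ {n} (λ i → *-comm (a i) (v i))

  ∙-zeroʳ : (a : Vector Carrier n) → a ∙ 0ⱽ ≈ 0#
  ∙-zeroʳ a = sum-zero (λ i → a i * 0#) (λ _ → zeroʳ _)

  ∙-vanish : (a : Vector Carrier n) {v : Vector Carrier n} → v ≋ 0ⱽ → a ∙ v ≈ 0#
  ∙-vanish a v≋0 = trans (∙-congˡ a v≋0) (∙-zeroʳ a)

  ∙-distribˡ-+ : (a v w : Vector Carrier n) → a ∙ (λ i → v i + w i) ≈ a ∙ v + a ∙ w
  ∙-distribˡ-+ a v w = begin
    a ∙ (λ i → v i + w i)       ≈⟨ ∙-congˡ a (λ i → +-congˡ (*-identityˡ (w i))) ⟨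
    a ∙ (λ i → v i + 1# * w i)  ≈⟨ ∙-linear a v w 1# ⟩
    a ∙ v + 1# * (a ∙ w)        ≈⟨ +-congˡ (*-identityˡ _) ⟩
    a ∙ v + a ∙ w               ∎

  ∙-scale : (a v : Vector Carrier n) (c : Carrier) → a ∙ (λ i → c * v i) ≈ c * (a ∙ v)
  ∙-scale {n} a v c = trans (sum-cong-≋ {n} (λ i → *-CS.x∙yz≈y∙xz (a i) c (v i)))
                            (sym (*-distribˡ-sum {n} c (λ i → a i * v i)))

  combination : Vector Carrier d → Vector (Vector Carrier n) d → Vector Carrier n
  combination {d} c b i = ∑[ j < d ] (c j * b j i)

  ·-as-combination : (A : Matrix m n) (v : Vector Carrier n) → A · v ≋ combination v (A ᵀ)
  ·-as-combination A v i = ∙-comm (A i) v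

  ∙-· : (a : Vector Carrier m) (B : Matrix m n) (w : Vector Carrier n) →
        a ∙ (B · w) ≈ (B ᵀ · a) ∙ w
  ∙-· {m} {n} a B w = begin
    a ∙ (B · w)                             ≈⟨ ∙-congˡ a (·-as-combination B w) ⟩
    a ∙ combination w (B ᵀ)                 ≈⟨ ∙-sum a w (B ᵀ) ⟩
    ∑[ j < n ] (w j * (a ∙ (B ᵀ) j))        ≈⟨ ∙-congˡ w (λ j → ∙-comm a ((B ᵀ) j)) ⟩
    w ∙ (B ᵀ · a)                           ≈⟨ ∙-comm w _ ⟩
    (B ᵀ · a) ∙ w                           ∎

  *ᴹ-· : ∀ {l} (A : Matrix l m) (B : Matrix m n) (v : Vector Carrier n) →
         (A *ᴹ B) · v ≋ A · (B · v)
  *ᴹ-· {m} {n} A B v i = begin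
    (A *ᴹ B) i ∙ v    ≈⟨ ∙-cong {w = v} (λ k → ∙-comm (A i) (λ j → B j k)) (λ _ → refl) ⟩
    (B ᵀ · A i) ∙ v   ≈⟨ ∙-· (A i) B v ⟨
    A i ∙ (B · v)     ∎

  -- Sums of squares

  <-respʳ : ∀ {x y z} → y ≈ z → x < y → x < z
  <-respʳ = proj₁ <-resp-≈

  <-respˡ : ∀ {x y z} → y ≈ z → y < x → z < x
  <-respˡ = proj₂ <-resp-≈

  0<x*x : ∀ {x} → ¬ x ≈ 0# → 0# < x * x
  0<x*x {x} x≉0 with compare x 0#
  ... | tri≈ _ x≈0 _ = contradiction x≈0 x≉0
  ... | tri> _ _ 0<x = *-pos 0<x 0<x
  ... | tri< x<0 _ _ = <-respʳ (trans (sym (-‿distribˡ-* _ _))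
                                (trans (-‿cong (sym (-‿distribʳ-* _ _))) (⁻¹-involutive _)))
                               (*-pos 0<-x 0<-x)
    where
    0<-x : 0# < - x
    0<-x = <-respˡ (-‿inverseʳ x) (<-respʳ (+-identityˡ _) (+-monoˡ-< (- x) x<0))

  0<x+y : ∀ {x y} → 0# < x → 0# < y → 0# < x + y
  0<x+y {x} {y} 0<x 0<y = <-trans (<-respʳ (sym (+-identityˡ y)) 0<y) (+-monoˡ-< y 0<x)

  -- Zero and positive are kept apart, rather than merged into non-negativity, so that the induction
  -- knows when all entries of the tail vanish.
  ∙-positive : (v : Vector Carrier n) → v ∙ v ≈ 0# × v ≋ 0ⱽ ⊎ 0# < v ∙ v
  ∙-positive {zero} v = inj₁ (refl , λ ())
  ∙-positive {suc n} v with v zero ≟ 0# | ∙-positive (Vector.tail v)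
  ... | yes v₀≈0 | inj₁ (eq , tl≈0) =
    inj₁ (trans (+-cong (trans (*-congʳ v₀≈0) (zeroˡ _)) eq) (+-identityˡ 0#) ,
          λ { zero → v₀≈0 ; (suc i) → tl≈0 i })
  ... | yes v₀≈0 | inj₂ pos =
    inj₂ (<-respʳ (sym (trans (+-congʳ (trans (*-congʳ v₀≈0) (zeroˡ _))) (+-identityˡ _))) pos)
  ... | no v₀≉0 | inj₁ (eq , _) =
    inj₂ (<-respʳ (sym (trans (+-congˡ eq) (+-identityʳ _))) (0<x*x v₀≉0))
  ... | no v₀≉0 | inj₂ pos = inj₂ (0<x+y (0<x*x v₀≉0) pos)

  ∙-definite : (v : Vector Carrier n) → v ∙ v ≈ 0# → v ≋ 0ⱽ
  ∙-definite v v∙v≈0 with ∙-positive v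
  ... | inj₁ (_ , v≋0) = v≋0
  ... | inj₂ 0<v∙v     = contradiction 0<v∙v (irrefl (sym v∙v≈0))

  -- Dimensions

  -- Elimination drops one basis vector or none for each equation. The case split follows that of
  -- `kernelBasis`.
  ≤-nullity : (A : Matrix m n) → n ℕ.≤ m ℕ.+ proj₁ (kernelBasis A)
  ≤-nullity {zero} A = ℕ.≤-refl
  ≤-nullity {suc m} A with kernelBasis (Vector.tail A) | ≤-nullity (Vector.tail A)
  ... | d , B | n≤m+d with any? (λ j → ¬? ((A zero ∙ Basis.vectors B j) ≟ 0#))
  ≤-nullity {suc m} A | suc d , B | n≤m+d | yes (p , Ab≉0) = ℕ.≤-trans n≤m+d (ℕ.≤-reflexive (ℕ.+-suc m d))
  -- The `no` case is split on the dimension because `kernelBasis` matches on it before it looks at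
  -- the result of the search.
  ≤-nullity {suc m} A | zero  , B | n≤m+d | no _ = ℕ.m≤n⇒m≤1+n n≤m+d
  ≤-nullity {suc m} A | suc d , B | n≤m+d | no _ = ℕ.m≤n⇒m≤1+n n≤m+d

  -- A basis of the zero space is empty, so the nullity in `≤-nullity` is zero.
  trivialKernel⇒≤ : (A : Matrix m n) → (∀ v → Kernel A v → v ≋ 0ⱽ) → n ℕ.≤ m
  trivialKernel⇒≤ {m} A trivial with kernelBasis A | ≤-nullity A
  ... | zero  , B | n≤m+0 = ℕ.≤-trans n≤m+0 (ℕ.≤-reflexive (ℕ.+-identityʳ m))
  -- With the first unit vector as coefficients the combination vanishes, and independence would
  -- give `1# ≈ 0#`.
  ... | suc d , B | _     = contradiction (independent (δ zero) eq zero) 1≉0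
    where
    open Basis B
    eq : combination (δ zero) vectors ≋ 0ⱽ
    eq i = sum-zero {suc d} (λ j → δ zero j * vectors j i)
                    (λ j → trans (*-congˡ (trivial (vectors j) (contained j) i)) (zeroʳ _))

  -- Having a `Basis` does not make a predicate a subspace; this is the part of linearity that
  -- `injective⇒≤` draws on.
  ClosedUnderCombinations : Pred (Vector Carrier n) 0ℓ → Set
  ClosedUnderCombinations {n} W = ∀ {d} (c : Vector Carrier d) (b : Vector (Vector Carrier n) d) →
                                  (∀ j → W (b j)) → W (combination c b)

  Kernel-closed : (A : Matrix m n) → ClosedUnderCombinations (Kernel A)
  Kernel-closed A c b b∈K i = trans (∙-sum (A i) c b) (∙-vanish c (λ j → b∈K j i))

  Eigenspace-closed : (A : Matrix n n) (x : Carrier) → ClosedUnderCombinations (Eigenspace A x)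
  Eigenspace-closed {n} A x {d} c b b∈E i = begin
    A i ∙ combination c b             ≈⟨ ∙-sum (A i) c b ⟩
    ∑[ j < d ] (c j * (A i ∙ b j))    ≈⟨ ∙-congˡ c (λ j → b∈E j i) ⟩
    ∑[ j < d ] (c j * (x * b j i))    ≈⟨ ∙-scale c (λ j → b j i) x ⟩
    x * combination c b i             ∎

  -- The coordinates of the images of one basis with respect to the other form a matrix `C`. A
  -- vector in its kernel describes a combination that `T` sends to zero, so it is itself zero, and
  -- `trivialKernel⇒≤` compares the numbers of columns and rows.
  injective⇒≤ : ∀ {W : Pred (Vector Carrier m) 0ℓ} {W′ : Pred (Vector Carrier n) 0ℓ} →
                Basis W d → Basis W′ d′ → ClosedUnderCombinations W → (T : Matrix n m) →
                (∀ v → W v → W′ (T · v)) → (∀ v → W v → T · v ≋ 0ⱽ → v ≋ 0ⱽ) → d ℕ.≤ d′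
  injective⇒≤ {d = d} {d′} {W = W} B B′ closed T T∈ T-injective = trivialKernel⇒≤ C trivial
    where
    module B = Basis B
    module B′ = Basis B′
    coefficients : ∀ j → ∃ λ (c : Vector Carrier d′) → T · B.vectors j ≋ combination c B′.vectors
    coefficients j = B′.spanning (T∈ _ (B.contained j))
    C : Matrix d′ d
    C i j = proj₁ (coefficients j) i
    trivial : ∀ k → Kernel C k → k ≋ 0ⱽ
    trivial k Ck≈0 = B.independent k (T-injective _ (closed k B.vectors B.contained) image≈0)
      where
      image≈0 : T · combination k B.vectors ≋ 0ⱽ
      image≈0 i = begin
        T i ∙ combination k B.vectors                      ≈⟨ ∙-sum (T i) k B.vectors ⟩
        k ∙ (λ j → T i ∙ B.vectors j)                      ≈⟨ ∙-congˡ k (λ j → proj₂ (coefficients j) i) ⟩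
        k ∙ (λ j → (λ l → C l j) ∙ (λ l → B′.vectors l i)) ≡⟨⟩
        k ∙ (C ᵀ · (λ l → B′.vectors l i))                 ≈⟨ ∙-· k (C ᵀ) _ ⟩
        (C · k) ∙ (λ l → B′.vectors l i)                   ≈⟨ ∙-comm (C · k) _ ⟩
        (λ l → B′.vectors l i) ∙ (C · k)                   ≈⟨ ∙-vanish (λ l → B′.vectors l i) Ck≈0 ⟩
        0#                                                 ∎

  Basis-resp : ∀ {W W′ : Pred (Vector Carrier n) 0ℓ} → (∀ v → W v → W′ v) → (∀ v → W′ v → W v) →
               Basis W d → Basis W′ d
  Basis-resp to from B = record
    { vectors = vectors ; contained = λ j → to _ (contained j)
    ; independent = independent ; spanning = λ v∈W′ → spanning (from _ v∈W′) }
    where open Basis B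

  sum-++ : ∀ m {n} (f : Vector Carrier (m ℕ.+ n)) →
           sum f ≈ ∑[ i < m ] f (i ↑ˡ n) + ∑[ j < n ] f (m ↑ʳ j)
  sum-++ zero    f = sym (+-identityˡ _)
  sum-++ (suc m) f = trans (+-congˡ (sum-++ m (Vector.tail f))) (sym (+-assoc _ _ _))

  ++-∙ : (a : Vector Carrier m) (b : Vector Carrier n) (u : Vector Carrier (m ℕ.+ n)) →
         (a Vector.++ b) ∙ u ≈ a ∙ (λ i → u (i ↑ˡ n)) + b ∙ (λ j → u (m ↑ʳ j))
  ++-∙ {m} {n} a b u = trans (sum-++ m (λ i → (a Vector.++ b) i * u i))
    (+-cong (sum-cong-≋ {m} (λ i → *-congʳ (reflexive (lookup-++ˡ a b i))))
            (sum-cong-≋ {n} (λ j → *-congʳ (reflexive (lookup-++ʳ a b j)))))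

  -- The linear map (v , w) ↦ (Bv + w , (v ∙ bₗ)ₗ) on ℝⁿ × ker Bᵀ, where the
  -- bₗ form a basis of ker B, is injective because ker Bᵀ ⟂ im B.
  nullity-transpose-≤ : (B : Matrix m n) → Basis (Kernel B) d → Basis (Kernel (B ᵀ)) d′ →
                        n ℕ.+ d′ ℕ.≤ m ℕ.+ d
  nullity-transpose-≤ {m} {n} {d} {d′} B K K′ = trivialKernel⇒≤ M trivial
    where
    module K = Basis K
    module K′ = Basis K′

    top : Matrix m (n ℕ.+ d′)
    top i = B i Vector.++ (λ j → K′.vectors j i)

    bottom : Matrix d (n ℕ.+ d′)
    bottom l = K.vectors l Vector.++ 0ⱽ

    M : Matrix (m ℕ.+ d) (n ℕ.+ d′)
    M = top Vector.++ bottom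

    module Injectivity (u : Vector Carrier (n ℕ.+ d′)) (Mu≈0 : Kernel M u) where
      v : Vector Carrier n
      v i = u (i ↑ˡ d′)
      c : Vector Carrier d′
      c j = u (n ↑ʳ j)
      w : Vector Carrier m
      w = combination c K′.vectors

      Bv+w≈0 : ∀ i → (B · v) i + w i ≈ 0#
      Bv+w≈0 i = begin
        B i ∙ v + w i                            ≈⟨ +-congˡ (∙-comm c (λ j → K′.vectors j i)) ⟩
        B i ∙ v + (λ j → K′.vectors j i) ∙ c     ≈⟨ ++-∙ (B i) (λ j → K′.vectors j i) u ⟨
        top i ∙ u                                ≈⟨ ∙-cong {w = u} (λ j → reflexive (≡.cong-app (lookup-++ˡ top bottom i) j)) (λ _ → refl) ⟨
        M (i ↑ˡ d) ∙ u                           ≈⟨ Mu≈0 (i ↑ˡ d) ⟩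
        0#                                       ∎

      b∙v≈0 : ∀ l → K.vectors l ∙ v ≈ 0#
      b∙v≈0 l = begin
        K.vectors l ∙ v                          ≈⟨ +-identityʳ _ ⟨
        K.vectors l ∙ v + 0#                     ≈⟨ +-congˡ (trans (∙-comm 0ⱽ c) (∙-zeroʳ c)) ⟨
        K.vectors l ∙ v + 0ⱽ ∙ c                 ≈⟨ ++-∙ (K.vectors l) 0ⱽ u ⟨
        bottom l ∙ u                             ≈⟨ ∙-cong {w = u} (λ j → reflexive (≡.cong-app (lookup-++ʳ top bottom l) j)) (λ _ → refl) ⟨
        M (m ↑ʳ l) ∙ u                           ≈⟨ Mu≈0 (m ↑ʳ l) ⟩
        0#                                       ∎

      Bv∙w≈0 : (B · v) ∙ w ≈ 0#
      Bv∙w≈0 = begin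
        (B · v) ∙ w        ≈⟨ ∙-comm (B · v) w ⟩
        w ∙ (B · v)        ≈⟨ ∙-· w B v ⟩
        (B ᵀ · w) ∙ v      ≈⟨ ∙-comm (B ᵀ · w) v ⟩
        v ∙ (B ᵀ · w)      ≈⟨ ∙-vanish v (Kernel-closed (B ᵀ) c K′.vectors K′.contained) ⟩
        0#                 ∎

      Bv≈0 : B · v ≋ 0ⱽ
      Bv≈0 = ∙-definite _ (begin
        (B · v) ∙ (B · v)                       ≈⟨ +-identityʳ _ ⟨
        (B · v) ∙ (B · v) + 0#                  ≈⟨ +-congˡ Bv∙w≈0 ⟨
        (B · v) ∙ (B · v) + (B · v) ∙ w         ≈⟨ ∙-distribˡ-+ (B · v) (B · v) w ⟨
        (B · v) ∙ (λ i → (B · v) i + w i)       ≈⟨ ∙-vanish (B · v) Bv+w≈0 ⟩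
        0#                                      ∎)

      c≈0 : c ≋ 0ⱽ
      c≈0 = K′.independent c λ i → begin
        w i                 ≈⟨ +-identityˡ (w i) ⟨
        0# + w i            ≈⟨ +-congʳ (Bv≈0 i) ⟨
        (B · v) i + w i     ≈⟨ Bv+w≈0 i ⟩
        0#                  ∎

      -- By now `v` lies in the kernel of `B` and is orthogonal to a basis of that kernel, hence to
      -- itself.
      v≈0 : v ≋ 0ⱽ
      v≈0 with K.spanning Bv≈0
      ... | k , v≋ = ∙-definite v (begin
        v ∙ v                                ≈⟨ ∙-congˡ v v≋ ⟩
        v ∙ combination k K.vectors          ≈⟨ ∙-sum v k K.vectors ⟩
        k ∙ (λ l → v ∙ K.vectors l)          ≈⟨ ∙-vanish k (λ l → trans (∙-comm v (K.vectors l)) (b∙v≈0 l)) ⟩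
        0#                                   ∎)

    trivial : ∀ u → Kernel M u → u ≋ 0ⱽ
    trivial u Mu≈0 i with splitAt n i in eq
    ... | inj₁ j = ≡.subst (λ i → u i ≈ 0#) (splitAt⁻¹-↑ˡ eq) (v≈0 j)
      where open Injectivity u Mu≈0
    ... | inj₂ j = ≡.subst (λ i → u i ≈ 0#) (splitAt⁻¹-↑ʳ eq) (c≈0 j)
      where open Injectivity u Mu≈0

  -- Comparison of spectra

  δ-sym : ∀ (i j : Fin n) → δ i j ≈ δ j i
  δ-sym zero    zero    = refl
  δ-sym zero    (suc _) = refl
  δ-sym (suc _) zero    = refl
  δ-sym (suc i) (suc j) = δ-sym i j

  δ-∙ : ∀ (i : Fin n) v → δ i ∙ v ≈ v i
  δ-∙ {n} i v = trans (∙-comm (δ i) v) (trans (∙-congˡ v (δ-sym i)) (sum-δ v i))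

  multiplicityBasis : (A : Matrix n n) (x : Carrier) → Basis (Eigenspace A x) (multiplicity A x)
  multiplicityBasis A x = proj₂ (eigenspaceBasis A x)

  multiplicity-≤-size : (A : Matrix n n) (x : Carrier) → multiplicity A x ℕ.≤ n
  multiplicity-≤-size A x = trivialKernel⇒≤ (vectors ᵀ) λ c eq → independent c λ i →
    trans (∙-comm c (λ j → vectors j i)) (eq i)
    where open Basis (multiplicityBasis A x)

  multiplicity-empty : (A : Matrix n n) (x : Carrier) → n ≡ 0 → multiplicity A x ≡ 0
  multiplicity-empty A x ≡.refl = ℕ.n≤0⇒n≡0 (multiplicity-≤-size A x)

  -- The second hypothesis makes `T` injective; the first makes it carry eigenvectors to
  -- eigenvectors for the same eigenvalue.
  intertwining-≤ : (A : Matrix m m) (A′ : Matrix n n) (T : Matrix n m) →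
                   (∀ i j → (A′ *ᴹ T) i j ≈ (T *ᴹ A) i j) → (∀ i j → (T ᵀ *ᴹ T) i j ≈ δ i j) →
                   ∀ x → multiplicity A x ℕ.≤ multiplicity A′ x
  intertwining-≤ A A′ T A′T≈TA TᵀT≈1 x =
    injective⇒≤ (multiplicityBasis A x) (multiplicityBasis A′ x) (Eigenspace-closed A x) T T∈
      (λ v _ Tv≋0 i → begin
        v i                  ≈⟨ δ-∙ i v ⟨
        δ i ∙ v              ≈⟨ ∙-cong {w = v} (TᵀT≈1 i) (λ _ → refl) ⟨
        (T ᵀ *ᴹ T) i ∙ v     ≈⟨ *ᴹ-· (T ᵀ) T v i ⟩
        (T ᵀ) i ∙ (T · v)    ≈⟨ ∙-vanish ((T ᵀ) i) Tv≋0 ⟩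
        0#                   ∎)
    where
    T∈ : ∀ v → Eigenspace A x v → Eigenspace A′ x (T · v)
    T∈ v v∈E i = begin
      A′ i ∙ (T · v)        ≈⟨ *ᴹ-· A′ T v i ⟨
      (A′ *ᴹ T) i ∙ v       ≈⟨ ∙-cong {w = v} (A′T≈TA i) (λ _ → refl) ⟩
      (T *ᴹ A) i ∙ v        ≈⟨ *ᴹ-· T A v i ⟩
      T i ∙ (A · v)         ≈⟨ ∙-congˡ (T i) v∈E ⟩
      T i ∙ (λ j → x * v j) ≈⟨ ∙-scale (T i) v x ⟩
      x * (T i ∙ v)         ∎

  *-cancelʳ-≉ : ∀ {x y z} → ¬ x ≈ y → x * z ≈ y * z → z ≈ 0#
  *-cancelʳ-≉ {x} {y} {z} x≉y xz≈yz with inverse (x + - y) (λ eq → x≉y (x∙y⁻¹≈ε⇒x≈y x y eq))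
  ... | w , inv = begin
    z                          ≈⟨ *-identityˡ z ⟨
    1# * z                     ≈⟨ *-congʳ inv ⟨
    (x + - y) * w * z          ≈⟨ *-CS.xy∙z≈y∙xz _ w z ⟩
    w * ((x + - y) * z)        ≈⟨ *-congˡ (distribʳ z x (- y)) ⟩
    w * (x * z + - y * z)      ≈⟨ *-congˡ (+-cong xz≈yz (sym (-‿distribˡ-* y z))) ⟩
    w * (y * z + - (y * z))    ≈⟨ *-congˡ (-‿inverseʳ _) ⟩
    w * 0#                     ≈⟨ zeroʳ w ⟩
    0#                         ∎

  -- A = c − BBᵀ in the form A + BBᵀ = c.
  record Complements (c : Carrier) (A : Matrix m m) (B : Matrix m n) : Set where
    field complement : ∀ i j → A i j + (B *ᴹ B ᵀ) i j ≈ c * δ i j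

  open Complements public

  complements-· : ∀ {c} {A : Matrix m m} {B : Matrix m n} → Complements c A B →
                  ∀ v i → A i ∙ v + B i ∙ (B ᵀ · v) ≈ c * v i
  complements-· {c = c} {A} {B} A+BBᵀ≈c v i = begin
    A i ∙ v + B i ∙ (B ᵀ · v)                   ≈⟨ +-cong (∙-comm (A i) v) (sym (*ᴹ-· B (B ᵀ) v i)) ⟩
    v ∙ A i + (B *ᴹ B ᵀ) i ∙ v                  ≈⟨ +-congˡ (∙-comm ((B *ᴹ B ᵀ) i) v) ⟩
    v ∙ A i + v ∙ (B *ᴹ B ᵀ) i                  ≈⟨ ∙-distribˡ-+ v (A i) ((B *ᴹ B ᵀ) i) ⟨
    v ∙ (λ j → A i j + (B *ᴹ B ᵀ) i j)          ≈⟨ ∙-congˡ v (complement A+BBᵀ≈c i) ⟩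
    v ∙ (λ j → c * δ i j)                       ≈⟨ ∙-scale v (δ i) c ⟩
    c * (v ∙ δ i)                               ≈⟨ *-congˡ (trans (∙-comm v (δ i)) (δ-∙ i v)) ⟩
    c * v i                                     ∎

  -- Bᵀ embeds the x-eigenspace of c − BBᵀ into that of c − BᵀB.
  complements-≤ : ∀ {c} {A : Matrix m m} {A′ : Matrix n n} {B : Matrix m n} →
                  Complements c A B → Complements c A′ (B ᵀ) →
                  ∀ {x} → ¬ x ≈ c → multiplicity A x ℕ.≤ multiplicity A′ x
  complements-≤ {c = c} {A} {A′} {B} A+BBᵀ≈c A′+BᵀB≈c {x} x≉c =
    injective⇒≤ (multiplicityBasis A x) (multiplicityBasis A′ x) (Eigenspace-closed A x) (B ᵀ) Bᵀ∈
      -- If `B ᵀ` kills `v`, then `A` acts on `v` both as `x` and as `c`, which forces `v` to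
      -- vanish.
      (λ v v∈E Bᵀv≋0 i → *-cancelʳ-≉ x≉c (begin
        x * v i                      ≈⟨ v∈E i ⟨
        A i ∙ v                      ≈⟨ +-identityʳ _ ⟨
        A i ∙ v + 0#                 ≈⟨ +-congˡ (∙-vanish (B i) Bᵀv≋0) ⟨
        A i ∙ v + B i ∙ (B ᵀ · v)    ≈⟨ complements-· A+BBᵀ≈c v i ⟩
        c * v i                      ∎))
    where
    Bᵀ∈ : ∀ v → Eigenspace A x v → Eigenspace A′ x (B ᵀ · v)
    -- `B ᵀ` intertwines `A` and `A′`: both composites are `c B ᵀ` minus `B ᵀ B B ᵀ`, and the latter
    -- term is cancelled.
    Bᵀ∈ v v∈E i = +-cancelʳ (BᵀB i) _ _ (begin
      A′ i ∙ (B ᵀ · v) + BᵀB i                                     ≈⟨ complements-· A′+BᵀB≈c (B ᵀ · v) i ⟩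
      c * ((B ᵀ) i ∙ v)                                            ≈⟨ ∙-scale ((B ᵀ) i) v c ⟨
      (B ᵀ) i ∙ (λ j → c * v j)                                    ≈⟨ ∙-congˡ ((B ᵀ) i) (complements-· A+BBᵀ≈c v) ⟨
      (B ᵀ) i ∙ (λ j → A j ∙ v + B j ∙ (B ᵀ · v))                  ≈⟨ ∙-distribˡ-+ ((B ᵀ) i) (A · v) (B · (B ᵀ · v)) ⟩
      (B ᵀ) i ∙ (A · v) + BᵀB i                                    ≈⟨ +-congʳ (∙-congˡ ((B ᵀ) i) v∈E) ⟩
      (B ᵀ) i ∙ (λ j → x * v j) + BᵀB i                            ≈⟨ +-congʳ (∙-scale ((B ᵀ) i) v x) ⟩
      x * ((B ᵀ) i ∙ v) + BᵀB i                                    ∎)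
      where
      BᵀB : Vector Carrier _
      BᵀB = B ᵀ · (B · (B ᵀ · v))

  -- As `B ᵀ ᵀ` is `B` by computation, the hypotheses are symmetric in the two matrices, so the
  -- embedding works in both directions.
  complements-≉ : ∀ {c} {A : Matrix m m} {A′ : Matrix n n} {B : Matrix m n} →
                  Complements c A B → Complements c A′ (B ᵀ) →
                  ∀ {x} → ¬ x ≈ c → multiplicity A x ≡ multiplicity A′ x
  complements-≉ {B = B} A+BBᵀ≈c A′+BᵀB≈c x≉c = ℕ.≤-antisym
    (complements-≤ A+BBᵀ≈c A′+BᵀB≈c x≉c) (complements-≤ A′+BᵀB≈c A+BBᵀ≈c x≉c)

  -- At the eigenvalue `c` the eigenspace is the kernel of `B B ᵀ`. Over the reals this is the
  -- kernel of `B ᵀ`, because the product of `v` with `B B ᵀ v` is the squared length of `B ᵀ v`.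
  complements-kernel : ∀ {c} {A : Matrix m m} {B : Matrix m n} → Complements c A B →
                       ∀ {x} → x ≈ c → Basis (Kernel (B ᵀ)) (multiplicity A x)
  complements-kernel {c = c} {A} {B} A+BBᵀ≈c {x} x≈c = Basis-resp to from (multiplicityBasis A x)
    where
    to : ∀ v → Eigenspace A x v → Kernel (B ᵀ) v
    to v v∈E = ∙-definite (B ᵀ · v) (trans (sym (∙-· v B (B ᵀ · v))) (∙-vanish v BBᵀv≋0))
      where
      BBᵀv≋0 : B · (B ᵀ · v) ≋ 0ⱽ
      BBᵀv≋0 i = +-cancelˡ (x * v i) _ _ (begin
        x * v i + B i ∙ (B ᵀ · v)    ≈⟨ +-congʳ (v∈E i) ⟨
        A i ∙ v + B i ∙ (B ᵀ · v)    ≈⟨ complements-· A+BBᵀ≈c v i ⟩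
        c * v i                      ≈⟨ *-congʳ x≈c ⟨
        x * v i                      ≈⟨ +-identityʳ _ ⟨
        x * v i + 0#                 ∎)
    from : ∀ v → Kernel (B ᵀ) v → Eigenspace A x v
    from v Bᵀv≋0 i = begin
      A i ∙ v                      ≈⟨ +-identityʳ _ ⟨
      A i ∙ v + 0#                 ≈⟨ +-congˡ (∙-vanish (B i) Bᵀv≋0) ⟨
      A i ∙ v + B i ∙ (B ᵀ · v)    ≈⟨ complements-· A+BBᵀ≈c v i ⟩
      c * v i                      ≈⟨ *-congʳ x≈c ⟨
      x * v i                      ∎

  -- Here the multiplicities are the nullities of `B ᵀ` and of `B`. As row rank equals column rank,
  -- these differ by the difference of the sizes.
  complements-≈ : ∀ {c} {A : Matrix m m} {A′ : Matrix n n} {B : Matrix m n} →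
                  Complements c A B → Complements c A′ (B ᵀ) →
                  ∀ {x} → x ≈ c → n ℕ.+ multiplicity A x ≡ m ℕ.+ multiplicity A′ x
  complements-≈ {B = B} A+BBᵀ≈c A′+BᵀB≈c x≈c = ℕ.≤-antisym
    (nullity-transpose-≤ B K K′) (nullity-transpose-≤ (B ᵀ) K′ K)
    where
    K′ = complements-kernel A+BBᵀ≈c x≈c
    K  = complements-kernel A′+BᵀB≈c x≈c

-- The boundary matrix of the full simplex.

module SubsetMatrices (ℝ : RealNumbers) where
  open RealNumbers ℝ hiding (zero; _-_)
  open RawSemiringDefinitions (Semiring.rawSemiring semiring) using (_^_)
  open Spectral ℝ
  open SemiringSum semiring using (sum-syntax; sum-cong-≋; *-distribˡ-sum)
  open Spectral.LinearSystems ℝ using (sum-zero)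
  open RingProperties ring using (-‿distribˡ-*; -‿distribʳ-*; -1*x≈-x)
  open AbelianGroupProperties +-abelianGroup using (⁻¹-involutive; ε⁻¹≈ε)
  module *-CS = CommutativeSemigroupProperties *-commutativeSemigroup
  module +-CS = CommutativeSemigroupProperties (CommutativeMonoid.commutativeSemigroup +-commutativeMonoid)
  open SetoidReasoning setoid

  private variable
    n : ℕ

  -- Recursion on the vertex set, rather than on the list of subsets, matches the block recursion of
  -- `d` and turns complementation into a swap of two summands.
  sumₛ : (Subset n → Carrier) → Carrier
  sumₛ {zero}  f = f []
  sumₛ {suc n} f = sumₛ (λ F → f (outside ∷ F)) + sumₛ (λ F → f (inside ∷ F))

  sumₛ-cong : {f g : Subset n → Carrier} → (∀ F → f F ≈ g F) → sumₛ f ≈ sumₛ g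
  sumₛ-cong {zero}  f≈g = f≈g []
  sumₛ-cong {suc n} f≈g = +-cong (sumₛ-cong (λ F → f≈g (outside ∷ F))) (sumₛ-cong (λ F → f≈g (inside ∷ F)))

  sumₛ-zero : {f : Subset n → Carrier} → (∀ F → f F ≈ 0#) → sumₛ f ≈ 0#
  sumₛ-zero {zero}  f≈0 = f≈0 []
  sumₛ-zero {suc n} f≈0 =
    trans (+-cong (sumₛ-zero (λ F → f≈0 (outside ∷ F))) (sumₛ-zero (λ F → f≈0 (inside ∷ F)))) (+-identityˡ 0#)

  sumₛ-+ : (f g : Subset n → Carrier) → sumₛ f + sumₛ g ≈ sumₛ (λ F → f F + g F)
  sumₛ-+ {zero}  f g = refl
  sumₛ-+ {suc n} f g = trans (+-CS.interchange _ _ _ _)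
    (+-cong (sumₛ-+ (λ F → f (outside ∷ F)) _) (sumₛ-+ (λ F → f (inside ∷ F)) _))

  *-sumₛ : (x : Carrier) (f : Subset n → Carrier) → x * sumₛ f ≈ sumₛ (λ F → x * f F)
  *-sumₛ {zero}  x f = refl
  *-sumₛ {suc n} x f = trans (distribˡ x _ _)
    (+-cong (*-sumₛ x (λ F → f (outside ∷ F))) (*-sumₛ x (λ F → f (inside ∷ F))))

  sumₛ-∁ : (f : Subset n → Carrier) → sumₛ (λ F → f (∁ F)) ≈ sumₛ f
  sumₛ-∁ {zero}  f = refl
  sumₛ-∁ {suc n} f = trans (+-comm _ _)
    (+-cong (sumₛ-∁ (λ F → f (outside ∷ F))) (sumₛ-∁ (λ F → f (inside ∷ F))))

  -- Sums over the positions of a list are the form in which products of matrices indexed by `faces`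
  -- arise.
  sumₗ : (xs : List (Subset n)) → (Subset n → Carrier) → Carrier
  sumₗ xs f = ∑[ i < length xs ] f (lookup xs i)

  sumₗ-++ : ∀ xs ys (f : Subset n → Carrier) → sumₗ (xs ++ ys) f ≈ sumₗ xs f + sumₗ ys f
  sumₗ-++ []       ys f = sym (+-identityˡ _)
  sumₗ-++ (x ∷ xs) ys f = trans (+-congˡ (sumₗ-++ xs ys f)) (sym (+-assoc _ _ _))

  sumₗ-map : ∀ {m} (g : Subset m → Subset n) xs (f : Subset n → Carrier) →
             sumₗ (List.map g xs) f ≈ sumₗ xs (λ F → f (g F))
  sumₗ-map g []       f = refl
  sumₗ-map g (x ∷ xs) f = +-congˡ (sumₗ-map g xs f)

  sumₗ-subsets : (f : Subset n → Carrier) → sumₗ (subsets n) f ≈ sumₛ f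
  sumₗ-subsets {zero}  f = +-identityʳ _
  sumₗ-subsets {suc n} f = trans (sumₗ-++ (List.map (outside ∷_) (subsets n)) _ f) (+-cong
    (trans (sumₗ-map (outside ∷_) (subsets n) f) (sumₗ-subsets (λ F → f (outside ∷ F))))
    (trans (sumₗ-map (inside ∷_) (subsets n) f) (sumₗ-subsets (λ F → f (inside ∷ F)))))

  sumₗ-filter-list : {P : Pred (Subset n) 0ℓ} (P? : Decidable P) → ∀ xs f →
                     sumₗ (filter P? xs) f ≈ sumₗ xs (λ F → if does (P? F) then f F else 0#)
  sumₗ-filter-list P? []       f = refl
  sumₗ-filter-list P? (x ∷ xs) f with does (P? x)
  ... | true  = +-congˡ (sumₗ-filter-list P? xs f)
  ... | false = trans (sumₗ-filter-list P? xs f) (sym (+-identityˡ _))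

  sumₗ-filter : {P : Pred (Subset n) 0ℓ} (P? : Decidable P) → ∀ f →
                sumₗ (filter P? (subsets n)) f ≈ sumₛ (λ F → if does (P? F) then f F else 0#)
  sumₗ-filter P? f = trans (sumₗ-filter-list P? (subsets _) f) (sumₗ-subsets (λ F → if does (P? F) then f F else 0#))

  δₛ : Subset n → Subset n → Carrier
  δₛ F G = if does (F ≟ₛ G) then 1# else 0#

  δₛ-≡ : (F : Subset n) → δₛ F F ≈ 1#
  δₛ-≡ F with F ≟ₛ F
  ... | yes _  = refl
  ... | no F≢F = contradiction ≡.refl F≢F

  δₛ-≢ : {F G : Subset n} → ¬ F ≡ G → δₛ F G ≈ 0#
  δₛ-≢ {F = F} {G} F≢G with F ≟ₛ G
  ... | yes F≡G = contradiction F≡G F≢G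
  ... | no _    = refl

  δₛ-sym : (F G : Subset n) → δₛ F G ≈ δₛ G F
  δₛ-sym F G with F ≟ₛ G | G ≟ₛ F
  ... | yes _   | yes _   = refl
  ... | no _    | no _    = refl
  ... | yes F≡G | no G≢F  = contradiction (≡.sym F≡G) G≢F
  ... | no F≢G  | yes G≡F = contradiction (≡.sym G≡F) F≢G

  δₛ-∁ : (F G : Subset n) → δₛ (∁ F) (∁ G) ≈ δₛ F G
  δₛ-∁ []            []            = refl
  δₛ-∁ (outside ∷ F) (outside ∷ G) = δₛ-∁ F G
  δₛ-∁ (outside ∷ F) (inside  ∷ G) = refl
  δₛ-∁ (inside  ∷ F) (outside ∷ G) = refl
  δₛ-∁ (inside  ∷ F) (inside  ∷ G) = δₛ-∁ F G

  sumₛ-δₛ : (F : Subset n) (f : Subset n → Carrier) → sumₛ (λ H → δₛ F H * f H) ≈ f F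
  sumₛ-δₛ []            f = *-identityˡ _
  sumₛ-δₛ {suc n} (outside ∷ F) f =
    trans (+-cong (sumₛ-δₛ F (λ G → f (outside ∷ G))) (sumₛ-zero {n} (λ _ → zeroˡ _))) (+-identityʳ _)
  sumₛ-δₛ {suc n} (inside  ∷ F) f =
    trans (+-cong (sumₛ-zero {n} (λ _ → zeroˡ _)) (sumₛ-δₛ F (λ G → f (inside ∷ G)))) (+-identityˡ _)

  -- The boundary matrix of the full simplex on Fin (suc n) consists of
  -- four blocks, according to whether the smallest vertex lies in G and in F.
  d : Subset n → Subset n → Carrier
  d []            []            = 0#
  d (outside ∷ G) (outside ∷ F) = d G F
  d (outside ∷ G) (inside  ∷ F) = δₛ G F
  d (inside  ∷ G) (outside ∷ F) = 0#
  d (inside  ∷ G) (inside  ∷ F) = - d G F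

  if-∧-false : ∀ b {x : Carrier} → (if b ∧ false then x else 0#) ≈ 0#
  if-∧-false b rewrite ∧-zeroʳ b = refl

  -- The smallest vertex has sign 1 and is the only one whose removal takes it out of the set, which
  -- gives the block `δₛ`. Its presence in `F` raises the position of every other vertex by one,
  -- which gives the minus sign.
  incidence≈d : (G F : Subset n) → incidence G F ≈ d G F
  incidence≈d []            []            = refl
  incidence≈d (outside ∷ G) (outside ∷ F) = trans (+-identityˡ _) (incidence≈d G F)
  incidence≈d (outside ∷ G) (inside  ∷ F) =
    -- Removing the smallest vertex leaves the tail in the form of `F` minus the empty set.
    trans (+-cong (reflexive (≡.cong (δₛ G) (p─⊥≡p F))) (sum-zero _ (λ v → if-∧-false (does (v ∈? F))))) (+-identityʳ _)
  incidence≈d (inside  ∷ G) (outside ∷ F) =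
    trans (+-identityˡ _) (sum-zero _ (λ v → if-∧-false (does (v ∈? F))))
  incidence≈d {suc n} (inside  ∷ G) (inside  ∷ F) = begin
    0# + ∑[ v < n ] (if c v then - 1# * x v else 0#)   ≈⟨ +-identityˡ _ ⟩
    ∑[ v < n ] (if c v then - 1# * x v else 0#)        ≈⟨ sum-cong-≋ {n} (λ v → pull (c v)) ⟩
    ∑[ v < n ] (- 1# * (if c v then x v else 0#))      ≈⟨ *-distribˡ-sum {n} (- 1#) (λ v → if c v then x v else 0#) ⟨
    - 1# * incidence G F                               ≈⟨ trans (-1*x≈-x _) (-‿cong (incidence≈d G F)) ⟩
    - d G F                                            ∎
    where
    c : Fin n → Bool
    c v = does ((v ∈? F) ×-dec (G ≟ₛ F - v))
    x : Fin n → Carrier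
    x v = (- 1#) ^ position v F
    pull : ∀ b {y} → (if b then - 1# * y else 0#) ≈ - 1# * (if b then y else 0#)
    pull true  = refl
    pull false = sym (zeroʳ _)

  -- The cardinality lets sums over faces of one size be extended to all subsets; the inclusion lets
  -- terms vanish because complexes are closed under subsets.
  d-support : (G F : Subset n) → d G F ≈ 0# ⊎ (G ⊆ F × ∣ F ∣ ≡ suc ∣ G ∣)
  d-support []            []            = inj₁ refl
  d-support (outside ∷ G) (outside ∷ F) = Sum.map₂ (λ (G⊆F , eq) → out⊆ G⊆F , eq) (d-support G F)
  d-support (outside ∷ G) (inside  ∷ F) with G ≟ₛ F
  ... | yes ≡.refl = inj₂ (out⊆ ⊆-refl , ≡.refl)
  ... | no _       = inj₁ refl
  d-support (inside  ∷ G) (outside ∷ F) = inj₁ refl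
  d-support (inside  ∷ G) (inside  ∷ F) = Sum.map (λ eq → trans (-‿cong eq) ε⁻¹≈ε)
    (λ (G⊆F , eq) → s⊆s G⊆F , ≡.cong suc eq) (d-support G F)

  -*-≈* : ∀ x y → - x * - y ≈ x * y
  -*-≈* x y = trans (sym (-‿distribˡ-* x (- y))) (trans (-‿cong (sym (-‿distribʳ-* x y))) (⁻¹-involutive _))

  parity : Subset n → Carrier
  parity []            = 1#
  parity (outside ∷ F) = parity F
  parity (inside  ∷ F) = - parity F

  parity² : (F : Subset n) → parity F * parity F ≈ 1#
  parity² []            = *-identityˡ 1#
  parity² (outside ∷ F) = parity² F
  parity² (inside  ∷ F) = trans (-*-≈* _ _) (parity² F)

  -- `parity` is (-1) to the power of the cardinality, and a nonzero entry of `d` joins sets whose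
  -- cardinalities differ by one.
  parity-d : (G F : Subset n) → parity F * parity G * d G F ≈ - d G F
  parity-d []            []            = trans (zeroʳ _) (sym ε⁻¹≈ε)
  parity-d (outside ∷ G) (outside ∷ F) = parity-d G F
  parity-d (outside ∷ G) (inside  ∷ F) with G ≟ₛ F
  ... | yes ≡.refl = trans (*-identityʳ _) (trans (sym (-‿distribˡ-* _ _)) (-‿cong (parity² F)))
  ... | no _       = trans (zeroʳ _) (sym ε⁻¹≈ε)
  parity-d (inside  ∷ G) (outside ∷ F) = trans (zeroʳ _) (sym ε⁻¹≈ε)
  parity-d (inside  ∷ G) (inside  ∷ F) = begin
    - parity F * - parity G * - d G F       ≈⟨ *-congʳ (-*-≈* _ _) ⟩
    parity F * parity G * - d G F           ≈⟨ -‿distribʳ-* _ _ ⟨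
    - (parity F * parity G * d G F)         ≈⟨ -‿cong (parity-d G F) ⟩
    - - d G F                               ∎

  -- σ F is the product of (-1)^v over the vertices v of F.
  σ : Subset n → Carrier
  σ []      = 1#
  σ (_ ∷ F) = parity F * σ F

  σ² : (F : Subset n) → σ F * σ F ≈ 1#
  σ² []      = *-identityˡ 1#
  σ² (s ∷ F) = trans (*-CS.interchange _ _ _ _) (trans (*-cong (parity² F) (σ² F)) (*-identityˡ 1#))

  σσδₛ : (F G : Subset n) → σ F * σ G * δₛ F G ≈ δₛ F G
  σσδₛ F G with F ≟ₛ G
  ... | yes ≡.refl = trans (*-congʳ (σ² F)) (*-identityˡ 1#)
  ... | no _       = zeroʳ _

  -- Suppose that `F` is `G` with a vertex v added. The signs of the two entries are given by the
  -- numbers of vertices below v in `∁ G` and in `G`. These numbers add up to v, and (-1)^v is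
  -- `σ F * σ G`.
  d-∁ : (F G : Subset n) → d (∁ F) (∁ G) ≈ σ F * σ G * d G F
  d-∁ []            []            = sym (zeroʳ _)
  d-∁ (outside ∷ F) (outside ∷ G) = begin
    - d (∁ F) (∁ G)                                    ≈⟨ -‿cong (d-∁ F G) ⟩
    - (σ F * σ G * d G F)                              ≈⟨ -‿distribʳ-* _ _ ⟩
    σ F * σ G * - d G F                                ≈⟨ *-congˡ (parity-d G F) ⟨
    σ F * σ G * (parity F * parity G * d G F)          ≈⟨ *-CS.x∙yz≈yx∙z _ _ _ ⟩
    parity F * parity G * (σ F * σ G) * d G F          ≈⟨ *-congʳ (*-CS.interchange _ _ _ _) ⟩
    parity F * σ F * (parity G * σ G) * d G F          ∎
  d-∁ (outside ∷ F) (inside  ∷ G) = sym (zeroʳ _)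
  d-∁ (inside  ∷ F) (outside ∷ G) = begin
    δₛ (∁ F) (∁ G)                                     ≈⟨ δₛ-∁ F G ⟩
    δₛ F G                                             ≈⟨ σσδₛ (inside ∷ F) (inside ∷ G) ⟨
    parity F * σ F * (parity G * σ G) * δₛ F G         ≈⟨ *-congˡ (δₛ-sym F G) ⟩
    parity F * σ F * (parity G * σ G) * δₛ G F         ∎
  d-∁ (inside  ∷ F) (inside  ∷ G) = begin
    d (∁ F) (∁ G)                                      ≈⟨ d-∁ F G ⟩
    σ F * σ G * d G F                                  ≈⟨ *-congˡ (⁻¹-involutive _) ⟨
    σ F * σ G * - - d G F                              ≈⟨ *-congˡ (-‿cong (parity-d G F)) ⟨
    σ F * σ G * - (parity F * parity G * d G F)        ≈⟨ *-congˡ (-‿distribʳ-* _ _) ⟩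
    σ F * σ G * (parity F * parity G * - d G F)        ≈⟨ *-CS.x∙yz≈yx∙z _ _ _ ⟩
    parity F * parity G * (σ F * σ G) * - d G F        ≈⟨ *-congʳ (*-CS.interchange _ _ _ _) ⟩
    parity F * σ F * (parity G * σ G) * - d G F        ∎

  ι : ℕ → Carrier
  ι zero    = 0#
  ι (suc n) = 1# + ι n

  sumₛ-δₛδₛ : (F G : Subset n) → sumₛ (λ H → δₛ F H * δₛ G H) ≈ δₛ F G
  sumₛ-δₛδₛ F G = trans (sumₛ-δₛ F (δₛ G)) (δₛ-sym G F)

  -- Induction on the vertex set. The identity block of `d` adds 1 to each of the two diagonal
  -- blocks, and the off-diagonal blocks cancel because the two copies of the smaller `d` carry
  -- opposite signs.
  simplex-laplacian : (F G : Subset n) →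
    sumₛ (λ H → d F H * d G H) + sumₛ (λ H → d H F * d H G) ≈ ι n * δₛ F G
  simplex-laplacian []            []            = trans (+-cong (zeroˡ _) (zeroˡ _)) (trans (+-identityˡ _) (sym (zeroˡ _)))
  simplex-laplacian {suc n} (outside ∷ F) (outside ∷ G) = begin
    (sumₛ (λ H → d F H * d G H) + sumₛ (λ H → δₛ F H * δₛ G H)) + (sumₛ (λ H → d H F * d H G) + sumₛ {n} (λ H → 0# * 0#))
      ≈⟨ +-cong (+-congˡ (sumₛ-δₛδₛ F G)) (trans (+-congˡ (sumₛ-zero {n} (λ _ → zeroˡ _))) (+-identityʳ _)) ⟩
    sumₛ (λ H → d F H * d G H) + δₛ F G + sumₛ (λ H → d H F * d H G)  ≈⟨ +-CS.xy∙z≈y∙xz _ _ _ ⟩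
    δₛ F G + (sumₛ (λ H → d F H * d G H) + sumₛ (λ H → d H F * d H G)) ≈⟨ +-cong (sym (*-identityˡ _)) (simplex-laplacian F G) ⟩
    1# * δₛ F G + ι n * δₛ F G                       ≈⟨ distribʳ _ _ _ ⟨
    ι (suc n) * δₛ F G                               ∎
  simplex-laplacian {suc n} (outside ∷ F) (inside  ∷ G) = begin
    (sumₛ (λ H → d F H * 0#) + sumₛ (λ H → δₛ F H * - d G H)) + (sumₛ (λ H → d H F * δₛ H G) + sumₛ (λ H → 0# * - d H G))
      ≈⟨ +-cong (+-cong (sumₛ-zero {n} (λ _ → zeroʳ _)) (sumₛ-δₛ F (λ H → - d G H)))
                (+-cong (sumₛ-cong {n} (λ H → trans (*-comm _ _) (*-congʳ (δₛ-sym H G)))) (sumₛ-zero {n} (λ _ → zeroˡ _))) ⟩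
    (0# + - d G F) + (sumₛ (λ H → δₛ G H * d H F) + 0#)
      ≈⟨ +-cong (+-identityˡ _) (trans (+-identityʳ _) (sumₛ-δₛ G (λ H → d H F))) ⟩
    - d G F + d G F     ≈⟨ -‿inverseˡ _ ⟩
    0#                  ≈⟨ zeroʳ _ ⟨
    ι (suc n) * 0#      ∎
  simplex-laplacian {suc n} (inside  ∷ F) (outside ∷ G) = begin
    (sumₛ (λ H → 0# * d G H) + sumₛ (λ H → - d F H * δₛ G H)) + (sumₛ (λ H → δₛ H F * d H G) + sumₛ (λ H → - d H F * 0#))
      ≈⟨ +-cong (+-cong (sumₛ-zero {n} (λ _ → zeroˡ _)) (sumₛ-cong {n} (λ H → *-comm _ _)))
                (+-cong (sumₛ-cong {n} (λ H → *-congʳ (δₛ-sym H F))) (sumₛ-zero {n} (λ _ → zeroʳ _))) ⟩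
    (0# + sumₛ (λ H → δₛ G H * - d F H)) + (sumₛ (λ H → δₛ F H * d H G) + 0#)
      ≈⟨ +-cong (trans (+-identityˡ _) (sumₛ-δₛ G (λ H → - d F H))) (trans (+-identityʳ _) (sumₛ-δₛ F (λ H → d H G))) ⟩
    - d F G + d F G     ≈⟨ -‿inverseˡ _ ⟩
    0#                  ≈⟨ zeroʳ _ ⟨
    ι (suc n) * 0#      ∎
  simplex-laplacian {suc n} (inside  ∷ F) (inside  ∷ G) = begin
    (sumₛ {n} (λ H → 0# * 0#) + sumₛ (λ H → - d F H * - d G H)) + (sumₛ (λ H → δₛ H F * δₛ H G) + sumₛ (λ H → - d H F * - d H G))
      ≈⟨ +-cong (trans (+-cong (sumₛ-zero {n} (λ _ → zeroˡ _)) (sumₛ-cong {n} (λ H → -*-≈* _ _))) (+-identityˡ _))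
                (+-cong (trans (sumₛ-cong {n} (λ H → *-cong (δₛ-sym H F) (δₛ-sym H G))) (sumₛ-δₛδₛ F G)) (sumₛ-cong {n} (λ H → -*-≈* _ _))) ⟩
    sumₛ (λ H → d F H * d G H) + (δₛ F G + sumₛ (λ H → d H F * d H G))  ≈⟨ +-CS.x∙yz≈y∙xz _ _ _ ⟩
    δₛ F G + (sumₛ (λ H → d F H * d G H) + sumₛ (λ H → d H F * d H G)) ≈⟨ +-cong (sym (*-identityˡ _)) (simplex-laplacian F G) ⟩
    1# * δₛ F G + ι n * δₛ F G                       ≈⟨ distribʳ _ _ _ ⟨
    ι (suc n) * δₛ F G                               ∎

-- Complementary pairs, dual complexes and lists of faces.

Member : ∀ {n} → SimplicialPair n → Pred (Subset n) 0ℓ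
Member (Δ , Δ′) F = Face Δ F × ¬ Face Δ′ F

member? : ∀ {n} (P : SimplicialPair n) → Decidable (Member P)
member? (Δ , Δ′) F = Face? Δ F ×-dec ¬? (Face? Δ′ F)

single : ∀ {n} → SimplicialComplex n → SimplicialPair n
single Δ = Δ , emptyComplex

single⁺ : ∀ {n} {Δ : SimplicialComplex n} {F} → Face Δ F → Member (single Δ) F
single⁺ F∈Δ = F∈Δ , λ ()

record Complementary {n} (P P* : SimplicialPair n) : Set where
  field
    ∈⇒∁∈ : ∀ F → Member P F → Member P* (∁ F)
    ∁∈⇒∈ : ∀ F → Member P* (∁ F) → Member P F

-- Only the faces matter, not Face? and closed; this makes the relation
-- symmetric, whereas (Δ ^∨) ^∨ is not Δ itself.
record Dual {n} (Δ Δ* : SimplicialComplex n) : Set where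
  field
    ∉⇒∁∈ : ∀ F → ¬ Face Δ F → Face Δ* (∁ F)
    ∁∈⇒∉ : ∀ F → Face Δ* (∁ F) → ¬ Face Δ F

open Complementary
open Dual

Complementary-sym : ∀ {n} {P P* : SimplicialPair n} → Complementary P P* → Complementary P* P
Complementary-sym {P* = P*} c .∈⇒∁∈ F F∈P* =
  ∁∈⇒∈ c (∁ F) (≡.subst (Member P*) (≡.sym (∁-involutive F)) F∈P*)
Complementary-sym {P* = P*} c .∁∈⇒∈ F ∁F∈P =
  ≡.subst (Member P*) (∁-involutive F) (∈⇒∁∈ c (∁ F) ∁F∈P)

Dual-sym : ∀ {n} {Δ Δ* : SimplicialComplex n} → Dual Δ Δ* → Dual Δ* Δ
Dual-sym {Δ = Δ} {Δ*} dual .∉⇒∁∈ F F∉Δ* = decidable-stable (Face? Δ (∁ F)) λ ∁F∉Δ →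
  F∉Δ* (≡.subst (Face Δ*) (∁-involutive F) (∉⇒∁∈ dual (∁ F) ∁F∉Δ))
Dual-sym {Δ* = Δ*} dual .∁∈⇒∉ F ∁F∈Δ F∈Δ* =
  ∁∈⇒∉ dual (∁ F) (≡.subst (Face Δ*) (≡.sym (∁-involutive F)) F∈Δ*) ∁F∈Δ

∣F∣+∣∁F∣≡n : ∀ {n} (F : Subset n) → ∣ F ∣ ℕ.+ ∣ ∁ F ∣ ≡ n
∣F∣+∣∁F∣≡n F = ≡.trans (≡.cong (∣ F ∣ ℕ.+_) (∣∁p∣≡n∸∣p∣ F)) (ℕ.m+[n∸m]≡n (∣p∣≤n F))

∣∁F∣≡ : ∀ {n k j} (F : Subset n) → ∣ F ∣ ≡ k → k ℕ.+ j ≡ n → ∣ ∁ F ∣ ≡ j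
∣∁F∣≡ F ≡.refl k+j≡n = ℕ.+-cancelˡ-≡ ∣ F ∣ _ _ (≡.trans (∣F∣+∣∁F∣≡n F) (≡.sym k+j≡n))

subsets-unique : ∀ n → Unique (subsets n)
subsets-unique zero    = All.[] ∷ []
subsets-unique (suc n) = Unique.++⁺ (Unique.map⁺ ∷-injectiveʳ (subsets-unique n))
                                    (Unique.map⁺ ∷-injectiveʳ (subsets-unique n)) disjoint
  where
  disjoint : Disjoint (List.map (outside ∷_) (subsets n)) (List.map (inside ∷_) (subsets n))
  disjoint (F∈out , F∈in) with ∈-map⁻ (outside ∷_) F∈out | ∈-map⁻ (inside ∷_) F∈in
  ... | _ , _ , ≡.refl | _ , _ , ()

faces-unique : ∀ {n} (P : SimplicialPair n) k → Unique (faces P k)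
faces-unique P k = Unique.filter⁺ _ (subsets-unique _)

module _ {n} (P : SimplicialPair n) (k : ℕ) where

  face : Fin (length (faces P k)) → Subset n
  face = lookup (faces P k)

  face-spec : ∀ i → ∣ face i ∣ ≡ k × Member P (face i)
  face-spec i = All.lookup (all-filter _ (subsets n)) (∈-lookup i)

  ∣face∣ : ∀ i → ∣ face i ∣ ≡ k
  ∣face∣ i = proj₁ (face-spec i)

  face-member : ∀ i → Member P (face i)
  face-member i = proj₂ (face-spec i)

-- Laplacians as weighted sums over all subsets, and their behaviour under complementation.

module Laplacians (ℝ : RealNumbers) where
  open RealNumbers ℝ hiding (zero; _-_)
  open Spectral ℝ
  open Spectral.LinearSystems ℝ
  open LinearAlgebra ℝ
  open SubsetMatrices ℝ
  open SemiringSum semiring using (sum-syntax; sum-cong-≋)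
  open SetoidReasoning setoid

  private variable
    n : ℕ

  χ : SimplicialPair n → Subset n → Carrier
  χ P F = if does (member? P F) then 1# else 0#

  χ-∈ : (P : SimplicialPair n) {F : Subset n} → Member P F → χ P F ≈ 1#
  χ-∈ P {F} F∈P = reflexive (≡.cong (if_then 1# else 0#) (dec-true (member? P F) F∈P))

  χ-∉ : (P : SimplicialPair n) {F : Subset n} → ¬ Member P F → χ P F ≈ 0#
  χ-∉ P {F} F∉P = reflexive (≡.cong (if_then 1# else 0#) (dec-false (member? P F) F∉P))

  -- The list of faces is cut out by cardinality and membership. The support of `f` takes care of
  -- the cardinality, and membership becomes the factor `χ P`.
  sum-faces : (P : SimplicialPair n) (k : ℕ) (f : Subset n → Carrier) →
              (∀ F → f F ≈ 0# ⊎ ∣ F ∣ ≡ k) →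
              ∑[ i < length (faces P k) ] f (face P k i) ≈ sumₛ (λ F → χ P F * f F)
  sum-faces {n} P k f support = trans (sumₗ-filter _ f)
    (sumₛ-cong {n} (λ F → absorb (∣ F ∣ ℕ.≟ k) (member? P F) (support F)))
    where
    absorb : ∀ {A B : Set} {x} (a? : Dec A) (b? : Dec B) → x ≈ 0# ⊎ A →
             (if does (a? ×-dec b?) then x else 0#) ≈ (if does b? then 1# else 0#) * x
    absorb (yes _) (yes _) _          = sym (*-identityˡ _)
    absorb (yes _) (no _)  _          = sym (zeroˡ _)
    absorb (no _)  b?      (inj₁ x≈0) = sym (trans (*-congˡ x≈0) (zeroʳ _))
    absorb (no ¬a) b?      (inj₂ a)   = contradiction a ¬a

  sum-faces-δₛ : (P : SimplicialPair n) (k : ℕ) (E : Subset n) (f : Subset n → Carrier) →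
                 Member P E → ∣ E ∣ ≡ k →
                 ∑[ i < length (faces P k) ] (δₛ E (face P k i) * f (face P k i)) ≈ f E
  sum-faces-δₛ {n} P k E f E∈P ∣E∣≡k = begin
    ∑[ i < length (faces P k) ] (δₛ E (face P k i) * f (face P k i))   ≈⟨ sum-faces P k (λ F → δₛ E F * f F) support ⟩
    sumₛ (λ F → χ P F * (δₛ E F * f F))                               ≈⟨ sumₛ-cong {n} (λ F → *-CS.x∙yz≈y∙xz _ _ _) ⟩
    sumₛ (λ F → δₛ E F * (χ P F * f F))                               ≈⟨ sumₛ-δₛ E (λ F → χ P F * f F) ⟩
    χ P E * f E                                                        ≈⟨ trans (*-congʳ (χ-∈ P E∈P)) (*-identityˡ _) ⟩
    f E                                                                ∎
    where
    support : ∀ F → δₛ E F * f F ≈ 0# ⊎ ∣ F ∣ ≡ k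
    support F with E ≟ₛ F
    ... | yes ≡.refl = inj₂ ∣E∣≡k
    ... | no _       = inj₁ (zeroˡ _)

  δ≈δₛ : ∀ {xs : List (Subset n)} → Unique xs → ∀ i j → δ i j ≈ δₛ (lookup xs i) (lookup xs j)
  δ≈δₛ {xs = x ∷ _} (x∉ ∷ u) zero zero = sym (δₛ-≡ x)
  δ≈δₛ (x∉ ∷ u) zero    (suc j) = sym (δₛ-≢ (All.lookup x∉ (∈-lookup j)))
  δ≈δₛ (x∉ ∷ u) (suc i) zero    = sym (δₛ-≢ (λ eq → All.lookup x∉ (∈-lookup i) (≡.sym eq)))
  δ≈δₛ (x∉ ∷ u) (suc i) (suc j) = δ≈δₛ u i j

  -- With `ψ` read as a diagonal matrix, these are d ψ dᵀ, dᵀ ψ d and their sum. They are linear in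
  -- `ψ` and treat all cardinalities at once.
  up down lap : (Subset n → Carrier) → Subset n → Subset n → Carrier
  up   ψ F G = sumₛ (λ H → ψ H * (d F H * d G H))
  down ψ F G = sumₛ (λ H → ψ H * (d H F * d H G))
  lap  ψ F G = up ψ F G + down ψ F G

  vanishˡ : ∀ {x y z} → x ≈ 0# → z * (x * y) ≈ 0#
  vanishˡ x≈0 = trans (*-congˡ (trans (*-congʳ x≈0) (zeroˡ _))) (zeroʳ _)

  -- The entries of `d` already fix the cardinality of the intermediate set, so the weight `χ P`
  -- picks out exactly the faces in the neighbouring degree.
  laplacian≈lap : (P : SimplicialPair n) (k : ℕ) → ∀ i j →
                  laplacian P k i j ≈ lap (χ P) (face P k i) (face P k j)
  laplacian≈lap {n} P k i j = +-cong up≈ (down≈ k i j)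
    where
    up≈ : (∂ P k *ᴹ ∂ P k ᵀ) i j ≈ up (χ P) (face P k i) (face P k j)
    up≈ = trans
      (sum-cong-≋ {length (faces P (suc k))} (λ l → *-cong (incidence≈d (face P k i) (face P (suc k) l)) (incidence≈d (face P k j) (face P (suc k) l))))
      (sum-faces P (suc k) (λ H → d (face P k i) H * d (face P k j) H) λ H → Sum.map
        (λ eq → trans (*-congʳ eq) (zeroˡ _))
        (λ (_ , eq) → ≡.trans eq (≡.cong suc (∣face∣ P k i)))
        (d-support (face P k i) H))
    down≈ : ∀ k i j → downLaplacian P k i j ≈ down (χ P) (face P k i) (face P k j)
    -- The down part is zero by definition in degree 0; on the other side no set has one element
    -- fewer than the empty set.
    down≈ zero i j = sym (sumₛ-zero {n} λ H → Sum.[ vanishˡ {y = d H (face P 0 j)} {χ P H}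
      , (λ (_ , eq) → contradiction (≡.trans (≡.sym (∣face∣ P 0 i)) eq) λ ()) ]′ (d-support H (face P 0 i)))
    down≈ (suc k) i j = trans
      (sum-cong-≋ {length (faces P k)} (λ l → *-cong (incidence≈d (face P k l) (face P (suc k) i)) (incidence≈d (face P k l) (face P (suc k) j))))
      (sum-faces P k (λ H → d H (face P (suc k) i) * d H (face P (suc k) j)) λ H → Sum.map
        (λ eq → trans (*-congʳ eq) (zeroˡ _))
        (λ (_ , eq) → ℕ.suc-injective (≡.trans (≡.sym eq) (∣face∣ P (suc k) i)))
        (d-support H (face P (suc k) i)))

  lap-cong : {ψ ψ′ : Subset n → Carrier} → (∀ H → ψ H ≈ ψ′ H) → ∀ F G → lap ψ F G ≈ lap ψ′ F G
  lap-cong {n} ψ≈ψ′ F G = +-cong (sumₛ-cong {n} (λ H → *-congʳ (ψ≈ψ′ H))) (sumₛ-cong {n} (λ H → *-congʳ (ψ≈ψ′ H)))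

  -- By linearity in the weight, the two sum to the Laplacian of the full simplex.
  lap-complement : (ψ ψ′ : Subset n → Carrier) → (∀ H → ψ H + ψ′ H ≈ 1#) →
                   ∀ F G → lap ψ F G + lap ψ′ F G ≈ ι n * δₛ F G
  lap-complement {n} ψ ψ′ ψ+ψ′≈1 F G = trans (+-CS.interchange _ _ _ _)
    (trans (+-cong (merge (λ H → d F H * d G H)) (merge (λ H → d H F * d H G))) (simplex-laplacian F G))
    where
    merge : ∀ f → sumₛ (λ H → ψ H * f H) + sumₛ (λ H → ψ′ H * f H) ≈ sumₛ f
    merge f = trans (sumₛ-+ (λ H → ψ H * f H) (λ H → ψ′ H * f H)) (sumₛ-cong {n} λ H →
      trans (sym (distribʳ _ _ _)) (trans (*-congʳ (ψ+ψ′≈1 H)) (*-identityˡ _)))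

  signs-cancel : ∀ {a b s x y} → s * s ≈ 1# → (a * s * x) * (b * s * y) ≈ a * b * (x * y)
  signs-cancel {a} {b} {s} {x} {y} s²≈1 = begin
    (a * s * x) * (b * s * y)      ≈⟨ *-CS.interchange _ _ _ _ ⟩
    (a * s * (b * s)) * (x * y)    ≈⟨ *-congʳ (*-CS.interchange _ _ _ _) ⟩
    (a * b * (s * s)) * (x * y)    ≈⟨ *-congʳ (trans (*-congˡ s²≈1) (*-identityʳ _)) ⟩
    a * b * (x * y)                ∎

  -- Complementation exchanges the two halves of the Laplacian.
  lap-∁ : (ψ : Subset n → Carrier) (F G : Subset n) →
          lap ψ (∁ F) (∁ G) ≈ σ F * σ G * lap (ψ ∘ ∁) F G
  lap-∁ {n} ψ F G = begin
    lap ψ (∁ F) (∁ G)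
      ≈⟨ +-cong (sumₛ-∁ (λ H → ψ H * (d (∁ F) H * d (∁ G) H))) (sumₛ-∁ (λ H → ψ H * (d H (∁ F) * d H (∁ G)))) ⟨
    sumₛ (λ H → ψ (∁ H) * (d (∁ F) (∁ H) * d (∁ G) (∁ H))) + sumₛ (λ H → ψ (∁ H) * (d (∁ H) (∁ F) * d (∁ H) (∁ G)))
      ≈⟨ +-cong (sumₛ-cong {n} λ H → *-congˡ (trans (*-cong (d-∁ F H) (d-∁ G H)) (signs-cancel (σ² H))))
                (sumₛ-cong {n} λ H → *-congˡ (trans (*-cong (trans (d-∁ H F) (*-congʳ (*-comm _ _))) (trans (d-∁ H G) (*-congʳ (*-comm _ _)))) (signs-cancel (σ² H)))) ⟩
    sumₛ (λ H → ψ (∁ H) * (σ F * σ G * (d H F * d H G))) + sumₛ (λ H → ψ (∁ H) * (σ F * σ G * (d F H * d G H)))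
      ≈⟨ +-cong (pull (λ H → d H F * d H G)) (pull (λ H → d F H * d G H)) ⟩
    σ F * σ G * down (ψ ∘ ∁) F G + σ F * σ G * up (ψ ∘ ∁) F G
      ≈⟨ trans (+-comm _ _) (sym (distribˡ _ _ _)) ⟩
    σ F * σ G * lap (ψ ∘ ∁) F G  ∎
    where
    pull : ∀ f → sumₛ (λ H → ψ (∁ H) * (σ F * σ G * f H)) ≈ σ F * σ G * sumₛ (λ H → ψ (∁ H) * f H)
    pull f = trans (sumₛ-cong {n} (λ H → *-CS.x∙yz≈y∙xz _ _ _)) (sym (*-sumₛ _ (λ H → ψ (∁ H) * f H)))

  module _ {P P* : SimplicialPair n} (c : Complementary P P*) where

    χ-∁ : ∀ F → χ P* (∁ F) ≈ χ P F
    χ-∁ F with member? P F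
    ... | yes F∈P = trans (χ-∈ P* (∈⇒∁∈ c F F∈P)) (sym (χ-∈ P F∈P))
    ... | no F∉P  = trans (χ-∉ P* (λ ∁F∈P* → F∉P (∁∈⇒∈ c F ∁F∈P*))) (sym (χ-∉ P F∉P))

    -- `T` sends a face to its complement with the sign `σ`. It is a signed permutation matrix, and
    -- its signs absorb those of `lap-∁`, so that it conjugates one Laplacian into the other.
    complementary-≤ : ∀ {k j} → k ℕ.+ j ≡ n → ∀ x →
                      multiplicity (laplacian P k) x ℕ.≤ multiplicity (laplacian P* j) x
    complementary-≤ {k} {j} k+j≡n = intertwining-≤ (laplacian P k) (laplacian P* j) T LT≈TL TᵀT≈1
      where
      T : Matrix (length (faces P* j)) (length (faces P k))
      T a b = δₛ (∁ (face P k b)) (face P* j a) * σ (face P k b)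

      ∣∁face∣ : ∀ b → ∣ ∁ (face P k b) ∣ ≡ j
      ∣∁face∣ b = ∣∁F∣≡ (face P k b) (∣face∣ P k b) k+j≡n

      ∣∁face*∣ : ∀ a → ∣ ∁ (face P* j a) ∣ ≡ k
      ∣∁face*∣ a = ∣∁F∣≡ (face P* j a) (∣face∣ P* j a) (≡.trans (ℕ.+-comm j k) k+j≡n)

      ∁face∈ : ∀ b → Member P* (∁ (face P k b))
      ∁face∈ b = ∈⇒∁∈ c _ (face-member P k b)

      ∁face*∈ : ∀ a → Member P (∁ (face P* j a))
      ∁face*∈ a = ∈⇒∁∈ (Complementary-sym c) _ (face-member P* j a)

      LT≈TL : ∀ a b → (laplacian P* j *ᴹ T) a b ≈ (T *ᴹ laplacian P k) a b
      LT≈TL a b = begin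
        ∑[ a′ < length (faces P* j) ] (laplacian P* j a a′ * (δₛ (∁ F) (face P* j a′) * σ F))
          ≈⟨ sum-cong-≋ {length (faces P* j)} (λ a′ → trans (*-congʳ (laplacian≈lap P* j a a′)) (*-CS.x∙yz≈y∙xz _ _ _)) ⟩
        ∑[ a′ < length (faces P* j) ] (δₛ (∁ F) (face P* j a′) * (lap (χ P*) G (face P* j a′) * σ F))
          ≈⟨ sum-faces-δₛ P* j (∁ F) (λ G′ → lap (χ P*) G G′ * σ F) (∁face∈ b) (∣∁face∣ b) ⟩
        lap (χ P*) G (∁ F) * σ F
          -- `G` is written as a double complement so that `lap-∁` applies to both arguments.
          ≈⟨ *-congʳ (reflexive (≡.cong (λ G′ → lap (χ P*) G′ (∁ F)) (∁-involutive G))) ⟨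
        lap (χ P*) (∁ (∁ G)) (∁ F) * σ F
          ≈⟨ *-congʳ (trans (lap-∁ (χ P*) (∁ G) F) (*-congˡ (lap-cong χ-∁ (∁ G) F))) ⟩
        σ (∁ G) * σ F * lap (χ P) (∁ G) F * σ F
          ≈⟨ *-CS.xy∙z≈xz∙y _ _ _ ⟩
        σ (∁ G) * σ F * σ F * lap (χ P) (∁ G) F
          ≈⟨ *-congʳ (trans (*-assoc _ _ _) (trans (*-congˡ (σ² F)) (*-identityʳ _))) ⟩
        σ (∁ G) * lap (χ P) (∁ G) F
          ≈⟨ sum-faces-δₛ P k (∁ G) (λ F′ → σ F′ * lap (χ P) F′ F) (∁face*∈ a) (∣∁face*∣ a) ⟨
        ∑[ b′ < length (faces P k) ] (δₛ (∁ G) (face P k b′) * (σ (face P k b′) * lap (χ P) (face P k b′) F))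
          ≈⟨ sum-cong-≋ {length (faces P k)} (λ b′ → trans (sym (*-assoc _ _ _)) (*-cong (*-congʳ (swap (face P k b′))) (sym (laplacian≈lap P k b′ b)))) ⟩
        ∑[ b′ < length (faces P k) ] (T a b′ * laplacian P k b′ b)  ∎
        where
        F = face P k b
        G = face P* j a
        swap : ∀ F′ → δₛ (∁ G) F′ ≈ δₛ (∁ F′) G
        swap F′ = trans (sym (δₛ-∁ (∁ G) F′)) (trans (reflexive (≡.cong (λ E → δₛ E (∁ F′)) (∁-involutive G))) (δₛ-sym G (∁ F′)))

      TᵀT≈1 : ∀ b b′ → (T ᵀ *ᴹ T) b b′ ≈ δ b b′
      TᵀT≈1 b b′ = begin
        ∑[ a < length (faces P* j) ] (δₛ (∁ F) (face P* j a) * σ F * (δₛ (∁ F′) (face P* j a) * σ F′))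
          ≈⟨ sum-cong-≋ {length (faces P* j)} (λ a → *-assoc _ _ _) ⟩
        ∑[ a < length (faces P* j) ] (δₛ (∁ F) (face P* j a) * (σ F * (δₛ (∁ F′) (face P* j a) * σ F′)))
          ≈⟨ sum-faces-δₛ P* j (∁ F) (λ G → σ F * (δₛ (∁ F′) G * σ F′)) (∁face∈ b) (∣∁face∣ b) ⟩
        σ F * (δₛ (∁ F′) (∁ F) * σ F′)
          ≈⟨ *-congˡ (*-congʳ (trans (δₛ-∁ F′ F) (δₛ-sym F′ F))) ⟩
        σ F * (δₛ F F′ * σ F′)
          ≈⟨ *-CS.x∙yz≈xz∙y _ _ _ ⟩
        σ F * σ F′ * δₛ F F′
          ≈⟨ σσδₛ F F′ ⟩
        δₛ F F′
          ≈⟨ δ≈δₛ (faces-unique P k) b b′ ⟨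
        δ b b′   ∎
        where
        F = face P k b
        F′ = face P k b′

  complementary-spectra : {P P* : SimplicialPair n} → Complementary P P* → ∀ {k j} → k ℕ.+ j ≡ n → ∀ x →
                          multiplicity (laplacian P k) x ≡ multiplicity (laplacian P* j) x
  complementary-spectra {P = P} {P*} c {k} {j} k+j≡n x = ℕ.≤-antisym
    (complementary-≤ c k+j≡n x)
    (complementary-≤ (Complementary-sym c) (≡.trans (ℕ.+-comm j k) k+j≡n) x)

-- Duality of deletion and contraction.

module _ {n} {Δ Δ* : SimplicialComplex (suc n)} (dual : Dual Δ Δ*) (e : Fin (suc n)) where

  -- Complementing in the larger vertex set also flips the slot `e`, so sets containing `e` become
  -- sets avoiding it.
  contraction-dual : Dual (contraction Δ e) (deletion Δ* e)
  contraction-dual .∉⇒∁∈ F F∉ = ≡.subst (Face Δ*) (map-insertAt _ inside F e) (∉⇒∁∈ dual _ F∉)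
  contraction-dual .∁∈⇒∉ F ∁F∈ = ∁∈⇒∉ dual _ (≡.subst (Face Δ*) (≡.sym (map-insertAt _ inside F e)) ∁F∈)

  deletion-dual : Dual (deletion Δ e) (contraction Δ* e)
  deletion-dual .∉⇒∁∈ F F∉ = ≡.subst (Face Δ*) (map-insertAt _ outside F e) (∉⇒∁∈ dual _ F∉)
  deletion-dual .∁∈⇒∉ F ∁F∈ = ∁∈⇒∉ dual _ (≡.subst (Face Δ*) (≡.sym (map-insertAt _ outside F e)) ∁F∈)

  -- The two conditions for membership change places: lying in one deletion means that the
  -- complement avoids the other contraction.
  pair-complementary : Complementary (deletion Δ e , contraction Δ e) (deletion Δ* e , contraction Δ* e)
  pair-complementary .∈⇒∁∈ F (F∈del , F∉con) =
    ∉⇒∁∈ contraction-dual F F∉con , λ ∁F∈con* → ∁∈⇒∉ deletion-dual F ∁F∈con* F∈del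
  pair-complementary .∁∈⇒∈ F (∁F∈del* , ∁F∉con*) =
    decidable-stable (Face? (deletion Δ e) F) (λ F∉del → ∁F∉con* (∉⇒∁∈ deletion-dual F F∉del)) ,
    ∁∈⇒∉ contraction-dual F ∁F∈del*

-- Counting faces.

faces-empty : ∀ {n} (P : SimplicialPair n) {k} → n ℕ.< k → length (faces P k) ≡ 0
faces-empty P {k} n<k = no-index (λ i → ℕ.<⇒≱ n<k (≡.subst (ℕ._≤ _) (∣face∣ P k i) (∣p∣≤n (face P k i))))
  where
  no-index : ∀ {m} → ¬ Fin m → m ≡ 0
  no-index {zero}  _ = ≡.refl
  no-index {suc m} ¬i = contradiction zero ¬i

length-filter-map : ∀ {m n} {P : Pred (Subset n) 0ℓ} (P? : Decidable P) (g : Subset m → Subset n) xs →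
                    length (filter P? (List.map g xs)) ≡ length (filter (P? ∘ g) xs)
length-filter-map P? g []       = ≡.refl
length-filter-map P? g (x ∷ xs) with does (P? (g x))
... | true  = ≡.cong suc (length-filter-map P? g xs)
... | false = length-filter-map P? g xs

#subsets : ∀ {n} {P : Pred (Subset n) 0ℓ} → Decidable P → ℕ
#subsets P? = length (filter P? (subsets _))

-- Only a split at the first vertex follows the construction of `subsets`. For a later `e`, split at
-- the first vertex, then at `e`, interchange the middle terms and undo the split at the first
-- vertex.
#subsets-insertAt : ∀ {n} {P : Pred (Subset (suc n)) 0ℓ} (P? : Decidable P) (e : Fin (suc n)) →
  #subsets P? ≡ #subsets (λ F → P? (insertAt F e outside)) ℕ.+ #subsets (λ F → P? (insertAt F e inside))
#subsets-insertAt {n} P? zero = begin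
  length (filter P? (List.map (outside ∷_) (subsets n) ++ List.map (inside ∷_) (subsets n)))
    ≡⟨ ≡.cong length (filter-++ P? (List.map (outside ∷_) (subsets n)) _) ⟩
  length (filter P? (List.map (outside ∷_) (subsets n)) ++ filter P? (List.map (inside ∷_) (subsets n)))
    ≡⟨ length-++ (filter P? (List.map (outside ∷_) (subsets n))) ⟩
  length (filter P? (List.map (outside ∷_) (subsets n))) ℕ.+ length (filter P? (List.map (inside ∷_) (subsets n)))
    ≡⟨ ≡.cong₂ ℕ._+_ (length-filter-map P? (outside ∷_) (subsets n)) (length-filter-map P? (inside ∷_) (subsets n)) ⟩
  #subsets (λ F → P? (outside ∷ F)) ℕ.+ #subsets (λ F → P? (inside ∷ F)) ∎
  where open ≡.≡-Reasoning
#subsets-insertAt {suc n} P? (suc e) = begin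
  #subsets P?
    ≡⟨ #subsets-insertAt P? zero ⟩
  #subsets (λ F → P? (outside ∷ F)) ℕ.+ #subsets (λ F → P? (inside ∷ F))
    ≡⟨ ≡.cong₂ ℕ._+_ (#subsets-insertAt (λ F → P? (outside ∷ F)) e) (#subsets-insertAt (λ F → P? (inside ∷ F)) e) ⟩
  (# outside outside ℕ.+ # outside inside) ℕ.+ (# inside outside ℕ.+ # inside inside)
    ≡⟨ interchange (# outside outside) (# outside inside) (# inside outside) (# inside inside) ⟩
  (# outside outside ℕ.+ # inside outside) ℕ.+ (# outside inside ℕ.+ # inside inside)
    ≡⟨ ≡.cong₂ ℕ._+_ (#subsets-insertAt (λ F → P? (insertAt F (suc e) outside)) zero) (#subsets-insertAt (λ F → P? (insertAt F (suc e) inside)) zero) ⟨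
  #subsets (λ F → P? (insertAt F (suc e) outside)) ℕ.+ #subsets (λ F → P? (insertAt F (suc e) inside)) ∎
  where
  open ≡.≡-Reasoning
  open import Algebra.Properties.CommutativeSemigroup ℕ.+-commutativeSemigroup using (interchange)
  # : _ → _ → ℕ
  # s t = #subsets (λ F → P? (s ∷ insertAt F e t))

∣insertAt-outside∣ : ∀ {n} (F : Subset n) e → ∣ insertAt F e outside ∣ ≡ ∣ F ∣
∣insertAt-outside∣ F             zero    = ≡.refl
∣insertAt-outside∣ (outside ∷ F) (suc e) = ∣insertAt-outside∣ F e
∣insertAt-outside∣ (inside  ∷ F) (suc e) = ≡.cong suc (∣insertAt-outside∣ F e)

∣insertAt-inside∣ : ∀ {n} (F : Subset n) e → ∣ insertAt F e inside ∣ ≡ suc ∣ F ∣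
∣insertAt-inside∣ F             zero    = ≡.refl
∣insertAt-inside∣ (outside ∷ F) (suc e) = ∣insertAt-inside∣ F e
∣insertAt-inside∣ (inside  ∷ F) (suc e) = ≡.cong suc (∣insertAt-inside∣ F e)

-- Spectra of dual complexes and transfer of the recursion.

module Duality (ℝ : RealNumbers) where
  open RealNumbers ℝ hiding (zero; _-_)
  open Spectral ℝ hiding (_≐_)
  open Spectral.LinearSystems ℝ
  open LinearAlgebra ℝ
  open SubsetMatrices ℝ
  open Laplacians ℝ
  open SemiringSum semiring using (sum-syntax; sum-cong-≋)
  open AbelianGroupProperties +-abelianGroup using (xyx⁻¹≈y; //-rightDividesˡ)

  private variable
    n : ℕ

  -- In cardinality -1, where there are no faces, this serves both as the Laplacian and as the block
  -- of the boundary matrix.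
  noRows : ∀ {m} → Matrix 0 m
  noRows ()

  module _ {Δ Δ* : SimplicialComplex n} (dual : Dual Δ Δ*) where
    private
      χΔ χΔ* χΔ*∁ : Subset n → Carrier
      χΔ    = χ (single Δ)
      χΔ*   = χ (single Δ*)
      χΔ*∁ F = χΔ* (∁ F)

    χ-dual : ∀ F → χΔ*∁ F + χΔ F ≈ 1#
    χ-dual F = Sum.[
      (λ F∈Δ → trans (+-cong (χ-∉ (single Δ*) (λ (∁F∈Δ* , _) → ∁∈⇒∉ dual F ∁F∈Δ* F∈Δ)) (χ-∈ (single Δ) (single⁺ {Δ = Δ} F∈Δ))) (+-identityˡ _)) ,
      (λ F∉Δ → trans (+-cong (χ-∈ (single Δ*) (single⁺ {Δ = Δ*} (∉⇒∁∈ dual F F∉Δ))) (χ-∉ (single Δ) (λ (F∈Δ , _) → F∉Δ F∈Δ))) (+-identityʳ _))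
      ]′ (toSum (Face? Δ F))

    open SetoidReasoning setoid

    -- Below a face there are only faces of `Δ`, whose complements have weight zero in the dual.
    lap-dual≈up : ∀ {F G} → Face Δ F → lap χΔ*∁ F G ≈ up χΔ*∁ F G
    lap-dual≈up {F} {G} F∈Δ = trans (+-congˡ (sumₛ-zero {n} λ H → Sum.[ vanishˡ {y = d H G} {χΔ*∁ H} ,
      (λ (H⊆F , _) → trans (*-congʳ (χ-∉ (single Δ*) (λ (∁H∈Δ* , _) → ∁∈⇒∉ dual H ∁H∈Δ* (closed Δ H⊆F F∈Δ)))) (zeroˡ _)) ]′
      (d-support H F))) (+-identityʳ _)

    -- Above a non-face there are only non-faces.
    lap≈down : ∀ {F G} → ¬ Face Δ F → lap χΔ F G ≈ down χΔ F G
    lap≈down {F} {G} F∉Δ = trans (+-congʳ (sumₛ-zero {n} λ H → Sum.[ vanishˡ {y = d G H} {χΔ H} ,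
      (λ (F⊆H , _) → trans (*-congʳ (χ-∉ (single Δ) (λ (H∈Δ , _) → F∉Δ (closed Δ F⊆H H∈Δ)))) (zeroˡ _)) ]′
      (d-support F H))) (+-identityˡ _)

    module _ (j : ℕ) where
      -- These are the non-faces of `Δ` with `n` minus `j` elements, indexed so as to match the rows
      -- of the dual Laplacian.
      coface : Fin (length (faces (single Δ*) j)) → Subset n
      coface b = ∁ (face (single Δ*) j b)

      ∁coface : ∀ b → ∁ (coface b) ≡ face (single Δ*) j b
      ∁coface b = ∁-involutive _

      coface∉ : ∀ b → ¬ Face Δ (coface b)
      coface∉ b = ∁∈⇒∉ dual (coface b) (≡.subst (Face Δ*) (≡.sym (∁coface b)) (proj₁ (face-member (single Δ*) j b)))

      -- Up to signs, the dual Laplacian is `lap` weighted by the non-faces of `Δ`. Its complement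
      -- in the full simplex is weighted by the faces, and on non-faces only the down part of that
      -- survives.
      dual-laplacian : ∀ b b′ → laplacian (single Δ*) j b b′ + σ (coface b) * σ (coface b′) * down χΔ (coface b) (coface b′) ≈ ι n * δ b b′
      dual-laplacian b b′ = begin
        laplacian (single Δ*) j b b′ + σ C * σ C′ * down χΔ C C′
          ≈⟨ +-cong (trans (laplacian≈lap (single Δ*) j b b′) (reflexive (≡.sym (≡.cong₂ (lap χΔ*) (∁coface b) (∁coface b′)))))
                    (*-congˡ (sym (lap≈down (coface∉ b)))) ⟩
        lap χΔ* (∁ C) (∁ C′) + σ C * σ C′ * lap χΔ C C′
          ≈⟨ +-congʳ (lap-∁ χΔ* C C′) ⟩
        σ C * σ C′ * lap χΔ*∁ C C′ + σ C * σ C′ * lap χΔ C C′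
          ≈⟨ distribˡ _ _ _ ⟨
        σ C * σ C′ * (lap χΔ*∁ C C′ + lap χΔ C C′)
          ≈⟨ *-congˡ (lap-complement χΔ*∁ χΔ χ-dual C C′) ⟩
        σ C * σ C′ * (ι n * δₛ C C′)
          ≈⟨ *-CS.x∙yz≈y∙xz _ _ _ ⟩
        ι n * (σ C * σ C′ * δₛ C C′)
          ≈⟨ *-congˡ (σσδₛ C C′) ⟩
        ι n * δₛ C C′
          ≈⟨ *-congˡ (trans (δₛ-∁ (face (single Δ*) j b) (face (single Δ*) j b′)) (sym (δ≈δₛ (faces-unique (single Δ*) j) b b′))) ⟩
        ι n * δ b b′ ∎
        where
        C = coface b
        C′ = coface b′

    module _ (k j : ℕ) (k+j+1≡n : suc k ℕ.+ j ≡ n) where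
      -- The block of `d` from the non-faces with `suc k` elements to the faces with `k` elements;
      -- the signs of its columns fit those of `dual-laplacian`.
      B : Matrix (length (faces (single Δ) k)) (length (faces (single Δ*) j))
      B a b = d (face (single Δ) k a) (coface j b) * σ (coface j b)

      complements : Complements (ι n) (laplacian (single Δ) k) B
      complements .complement a a′ = begin
        laplacian (single Δ) k a a′ + ∑[ b < length (faces (single Δ*) j) ] (B a b * B a′ b)
          ≈⟨ +-cong (laplacian≈lap (single Δ) k a a′) (sum-cong-≋ {length (faces (single Δ*) j)} (λ b →
               trans (*-CS.interchange _ _ _ _) (trans (*-congˡ (σ² (coface j b))) (*-identityʳ _)))) ⟩
        lap χΔ F F′ + ∑[ b < length (faces (single Δ*) j) ] (d F (coface j b) * d F′ (coface j b))
          ≈⟨ +-congˡ (sum-faces (single Δ*) j (λ G → d F (∁ G) * d F′ (∁ G)) support) ⟩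
        lap χΔ F F′ + sumₛ (λ G → χΔ* G * (d F (∁ G) * d F′ (∁ G)))
          -- With `G` as a double complement the summand depends on `∁ G` alone, and the sum can be
          -- reindexed.
          ≈⟨ +-congˡ (sumₛ-cong {n} (λ G → *-congʳ (reflexive (≡.cong χΔ* (∁-involutive G))))) ⟨
        lap χΔ F F′ + sumₛ (λ G → χΔ*∁ (∁ G) * (d F (∁ G) * d F′ (∁ G)))
          ≈⟨ +-congˡ (sumₛ-∁ (λ H → χΔ*∁ H * (d F H * d F′ H))) ⟩
        lap χΔ F F′ + up χΔ*∁ F F′
          ≈⟨ +-congˡ (lap-dual≈up (proj₁ (face-member (single Δ) k a))) ⟨
        lap χΔ F F′ + lap χΔ*∁ F F′
          ≈⟨ trans (+-comm _ _) (lap-complement χΔ*∁ χΔ χ-dual F F′) ⟩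
        ι n * δₛ F F′
          ≈⟨ *-congˡ (δ≈δₛ (faces-unique (single Δ) k) a a′) ⟨
        ι n * δ a a′  ∎
        where
        F = face (single Δ) k a
        F′ = face (single Δ) k a′
        support : ∀ G → d F (∁ G) * d F′ (∁ G) ≈ 0# ⊎ ∣ G ∣ ≡ j
        support G = Sum.map (λ eq → trans (*-congʳ eq) (zeroˡ _))
          (λ (_ , eq) → ≡.subst (λ G → ∣ G ∣ ≡ j) (∁-involutive G)
            (∣∁F∣≡ (∁ G) (≡.trans eq (≡.cong suc (∣face∣ (single Δ) k a))) k+j+1≡n))
          (d-support F (∁ G))

      complementsᵀ : Complements (ι n) (laplacian (single Δ*) j) (B ᵀ)
      complementsᵀ .complement b b′ = begin
        laplacian (single Δ*) j b b′ + ∑[ a < length (faces (single Δ) k) ] (B a b * B a b′)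
          ≈⟨ +-congˡ (sum-faces (single Δ) k (λ F → d F C * σ C * (d F C′ * σ C′)) support) ⟩
        laplacian (single Δ*) j b b′ + sumₛ (λ F → χΔ F * (d F C * σ C * (d F C′ * σ C′)))
          ≈⟨ +-congˡ (sumₛ-cong {n} (λ F → trans (*-congˡ (trans (*-CS.interchange _ _ _ _) (*-comm _ _))) (*-CS.x∙yz≈y∙xz _ _ _))) ⟩
        laplacian (single Δ*) j b b′ + sumₛ (λ F → σ C * σ C′ * (χΔ F * (d F C * d F C′)))
          ≈⟨ +-congˡ (*-sumₛ _ (λ F → χΔ F * (d F C * d F C′))) ⟨
        laplacian (single Δ*) j b b′ + σ C * σ C′ * down χΔ C C′
          ≈⟨ dual-laplacian j b b′ ⟩
        ι n * δ b b′ ∎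
        where
        C = coface j b
        C′ = coface j b′
        ∣C∣ : ∣ C ∣ ≡ suc k
        ∣C∣ = ∣∁F∣≡ (face (single Δ*) j b) (∣face∣ (single Δ*) j b) (≡.trans (ℕ.+-comm j (suc k)) k+j+1≡n)
        support : ∀ F → d F C * σ C * (d F C′ * σ C′) ≈ 0# ⊎ ∣ F ∣ ≡ k
        support F = Sum.map (λ eq → trans (*-congʳ (trans (*-congʳ eq) (zeroˡ _))) (zeroˡ _))
          (λ (_ , eq) → ℕ.suc-injective (≡.trans (≡.sym eq) ∣C∣)) (d-support F C)

    -- The case k = -1, in which B has no rows.
    top-complementsᵀ : Complements (ι n) (laplacian (single Δ*) n) (noRows ᵀ)
    top-complementsᵀ .complement b b′ = begin
      laplacian (single Δ*) n b b′ + 0#                              ≈⟨ +-congˡ (trans (*-congˡ down≈0) (zeroʳ _)) ⟨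
      laplacian (single Δ*) n b b′ + σ C * σ C′ * down χΔ C C′       ≈⟨ dual-laplacian n b b′ ⟩
      ι n * δ b b′                                                   ∎
      where
      C = coface n b
      C′ = coface n b′
      ∣C∣ : ∣ C ∣ ≡ 0
      ∣C∣ = ∣∁F∣≡ (face (single Δ*) n b) (∣face∣ (single Δ*) n b) (ℕ.+-identityʳ n)
      down≈0 : down χΔ C C′ ≈ 0#
      down≈0 = sumₛ-zero {n} λ H → Sum.[ vanishˡ {y = d H C′} {χΔ H} ,
        (λ (_ , eq) → contradiction (≡.trans (≡.sym ∣C∣) eq) λ ()) ]′ (d-support H C)

  κ : ℕ → Carrier → ℤ
  κ n x = if does (x ≟ ι n) then 1ℤ else 0ℤ

  -- The factor q shifts the exponent by one, just as deletion and contraction lose one vertex; so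
  -- the corrections at the eigenvalues `suc n` and `n` line up.
  κ-suc : ∀ n x → κ n (x + - 1#) ≡ κ (suc n) x
  κ-suc n x with (x + - 1#) ≟ ι n | x ≟ ι (suc n)
  ... | yes _  | yes _  = ≡.refl
  ... | no _   | no _   = ≡.refl
  ... | yes eq | no x≉  = contradiction (trans (sym (//-rightDividesˡ 1# x)) (trans (+-congʳ eq) (+-comm _ _))) x≉
  ... | no x≉  | yes eq = contradiction (trans (+-congʳ eq) (xyx⁻¹≈y 1# (ι n))) x≉

  -- Both cases of the comparison in one formula, over the integers because the difference of sizes
  -- may be negative.
  complements-multiplicity : ∀ n {l m} {A : Matrix l l} {A′ : Matrix m m} {B : Matrix l m} →
    Complements (ι n) A B → Complements (ι n) A′ (B ᵀ) →
    ∀ x → + multiplicity A′ x ≡ + multiplicity A x ℤ.+ κ n x ℤ.* (+ m ℤ.- + l)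
  complements-multiplicity n {l} {m} {A} {A′} c c′ x with x ≟ ι n
  ... | no x≉n  = ≡.trans (≡.cong +_ (≡.sym (complements-≉ c c′ x≉n))) (≡.sym (ℤ.+-identityʳ _))
  ... | yes x≈n = begin
    + a′                              ≡⟨ cancel (+ l) (+ a′) ⟩
    (+ l ℤ.+ + a′) ℤ.- + l            ≡⟨ ≡.cong (λ z → + z ℤ.- + l) (complements-≈ c c′ x≈n) ⟨
    (+ m ℤ.+ + a) ℤ.- + l             ≡⟨ shift (+ l) (+ m) (+ a) ⟩
    + a ℤ.+ 1ℤ ℤ.* (+ m ℤ.- + l)      ∎
    where
    open ≡.≡-Reasoning
    a  = multiplicity A x
    a′ = multiplicity A′ x
    cancel : ∀ l a′ → a′ ≡ (l ℤ.+ a′) ℤ.- l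
    cancel = solve-∀
    shift : ∀ l m a → (m ℤ.+ a) ℤ.- l ≡ a ℤ.+ 1ℤ ℤ.* (m ℤ.- l)
    shift = solve-∀

  #faces : SimplicialComplex n → GeneratingFunction
  #faces Δ k _ = + length (faces (single Δ) k)

  -- Dual faces of size `j` are complements of non-faces of size `k`, and the block `B` ties these
  -- to faces of size one less; hence the factor t.
  dual-spectrum : {Δ Δ* : SimplicialComplex n} → Dual Δ Δ* → ∀ k j → k ℕ.+ j ≡ n → ∀ x →
    S Δ* j x ≡ (t· S Δ) k x ℤ.+ κ n x ℤ.* (#faces Δ* j x ℤ.- (t· #faces Δ) k x)
  dual-spectrum {n} dual (suc k) j k+j≡n x = complements-multiplicity n (complements dual k j k+j≡n) (complementsᵀ dual k j k+j≡n) x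
  dual-spectrum {n} {Δ* = Δ*} dual zero .n ≡.refl x = ≡.trans
    (complements-multiplicity n {A = noRows} (record { complement = λ () }) (top-complementsᵀ dual) x)
    (≡.cong (λ a → + a ℤ.+ κ n x ℤ.* (#faces Δ* n x ℤ.- 0ℤ)) (multiplicity-empty noRows x ≡.refl))

  -- Face numbers ignore the exponent, so the two sides may be taken at different exponents, as the
  -- recursion requires.
  #faces-deletion-contraction : (Δ : SimplicialComplex (suc n)) (e : Fin (suc n)) → ∀ k x y →
    #faces Δ k x ≡ #faces (deletion Δ e) k y ℤ.+ (t· #faces (contraction Δ e)) k y
  #faces-deletion-contraction {n} Δ e k x y = ≡.trans (≡.cong +_ (#subsets-insertAt _ e))
    (≡.cong₂ (λ a b → + a ℤ.+ b) (≡.cong length (filter-≐ _ _ outside≐ (subsets n))) (inside-count k))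
    where
    outside≐ : (λ F → ∣ insertAt F e outside ∣ ≡ k × Member (single Δ) (insertAt F e outside))
                 ≐ (λ F → ∣ F ∣ ≡ k × Member (single (deletion Δ e)) F)
    outside≐ = (λ { {F} (eq , m) → ≡.trans (≡.sym (∣insertAt-outside∣ F e)) eq , m }) ,
               (λ { {F} (eq , m) → ≡.trans (∣insertAt-outside∣ F e) eq , m })
    inside-count : ∀ k → + #subsets (λ F → (∣ insertAt F e inside ∣ ℕ.≟ k) ×-dec member? (single Δ) (insertAt F e inside))
                       ≡ (t· #faces (contraction Δ e)) k y
    inside-count zero    = ≡.cong (+_ ∘ length) (filter-none _ (All.universal (λ F (eq , _) →
                             contradiction (≡.trans (≡.sym (∣insertAt-inside∣ F e)) eq) λ ()) (subsets n)))
    inside-count (suc k) = ≡.cong (+_ ∘ length) (filter-≐ _ _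
      ((λ { {F} (eq , m) → ℕ.suc-injective (≡.trans (≡.sym (∣insertAt-inside∣ F e)) eq) , m }) ,
       (λ { {F} (eq , m) → ≡.trans (∣insertAt-inside∣ F e) (≡.cong suc eq) , m })) (subsets n))

  spectrum-vanishes : (P : SimplicialPair n) {k : ℕ} → n ℕ.< k → ∀ x → spectrumPolynomial P k x ≡ 0ℤ
  spectrum-vanishes P {k} n<k x = ≡.cong +_ (multiplicity-empty (laplacian P k) x (faces-empty P n<k))

  -- Degrees are complementary in `suc n` while the complexes have `n` vertices. This costs one more
  -- factor t and adds the degree `suc n`, where everything vanishes.
  dual-spectrum-t : {Δ Δ* : SimplicialComplex n} → Dual Δ Δ* → ∀ k j → k ℕ.+ j ≡ suc n → ∀ x →
    S Δ* j x ≡ (t· t· S Δ) k x ℤ.+ κ n x ℤ.* (#faces Δ* j x ℤ.- (t· t· #faces Δ) k x)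
  dual-spectrum-t dual (suc k) j k+j≡n x = dual-spectrum dual k j (ℕ.suc-injective k+j≡n) x
  dual-spectrum-t {n} {Δ* = Δ*} dual zero .(suc n) ≡.refl x = begin
    S Δ* (suc n) x                                     ≡⟨ spectrum-vanishes (single Δ*) (ℕ.n<1+n n) x ⟩
    0ℤ                                                 ≡⟨ zero-identity (κ n x) ⟩
    0ℤ ℤ.+ κ n x ℤ.* (0ℤ ℤ.- 0ℤ)                       ≡⟨ ≡.cong (λ z → 0ℤ ℤ.+ κ n x ℤ.* (+ z ℤ.- 0ℤ)) (faces-empty (single Δ*) (ℕ.n<1+n n)) ⟨
    0ℤ ℤ.+ κ n x ℤ.* (#faces Δ* (suc n) x ℤ.- 0ℤ)      ∎
    where
    open ≡.≡-Reasoning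
    zero-identity : ∀ c → 0ℤ ≡ 0ℤ ℤ.+ c ℤ.* (0ℤ ℤ.- 0ℤ)
    zero-identity = solve-∀

  t-dual-spectrum : {Δ Δ* : SimplicialComplex n} → Dual Δ Δ* → ∀ k j → k ℕ.+ j ≡ suc n → ∀ x →
    (t· S Δ*) j x ≡ (t· S Δ) k x ℤ.+ κ n x ℤ.* ((t· #faces Δ*) j x ℤ.- (t· #faces Δ) k x)
  t-dual-spectrum dual k (suc j) k+j≡n x =
    dual-spectrum dual k j (ℕ.suc-injective (≡.trans (≡.sym (ℕ.+-suc k j)) k+j≡n)) x
  t-dual-spectrum dual zero zero () x
  -- Here `k` is `n`, and the only possible eigenvalue of `Δ` in this degree is `n`, with the number
  -- of faces as multiplicity. This is the duality read backwards in degree 0, and it cancels the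
  -- correction.
  t-dual-spectrum {n} {Δ} {Δ*} dual (suc k) zero k+0≡n x = begin
    0ℤ                                                                        ≡⟨ zero-identity (κ n x) (#faces Δ k x) ⟩
    (0ℤ ℤ.+ κ n x ℤ.* (#faces Δ k x ℤ.- 0ℤ)) ℤ.+ κ n x ℤ.* (0ℤ ℤ.- #faces Δ k x)
      ≡⟨ ≡.cong (ℤ._+ κ n x ℤ.* (0ℤ ℤ.- #faces Δ k x)) (dual-spectrum (Dual-sym dual) zero k (≡.trans (≡.sym (ℕ.+-identityʳ k)) (ℕ.suc-injective k+0≡n)) x) ⟨
    S Δ k x ℤ.+ κ n x ℤ.* (0ℤ ℤ.- #faces Δ k x)                               ∎
    where
    open ≡.≡-Reasoning
    zero-identity : ∀ c f → 0ℤ ≡ (0ℤ ℤ.+ c ℤ.* (f ℤ.- 0ℤ)) ℤ.+ c ℤ.* (0ℤ ℤ.- f)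
    zero-identity = solve-∀

  t-complementary-spectrum : {P P* : SimplicialPair n} → Complementary P P* → ∀ k j → k ℕ.+ j ≡ suc n → ∀ x →
    spectrumPolynomial P* j x ≡ (t· spectrumPolynomial P) k x
  t-complementary-spectrum c (suc k) j k+j≡n x =
    ≡.cong +_ (≡.sym (complementary-spectra c (ℕ.suc-injective k+j≡n) x))
  t-complementary-spectrum {P* = P*} c zero _ ≡.refl x = spectrum-vanishes P* (ℕ.n<1+n _) x

  module _ {Δ Δ* : SimplicialComplex (suc n)} (dual : Dual Δ Δ*) (e : Fin (suc n)) where
    private
      P P* : SimplicialPair n
      P = deletion Δ e , contraction Δ e
      P* = deletion Δ* e , contraction Δ* e

    -- A single coefficient of the recursion for `Δ*`, unfolded so that degrees within and beyond
    -- the vertex count can be treated separately.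
    RecursionAt : ℕ → Carrier → Set
    RecursionAt j x = S Δ* j x ≡
      S (deletion Δ* e) j (x + - 1#) ℤ.+ (t· S (contraction Δ* e)) j (x + - 1#)
        ℤ.+ (spectrumPolynomial P* j x ℤ.- spectrumPolynomial P* j (x + - 1#))

    recursion-above : ∀ j → suc n ℕ.< j → ∀ x → RecursionAt j x
    recursion-above (suc j) n<j x = ≡.trans (spectrum-vanishes (single Δ*) n<j x) (≡.sym (≡.cong₂ ℤ._+_
      (≡.cong₂ ℤ._+_ (spectrum-vanishes (single (deletion Δ* e)) (ℕ.<-trans (ℕ.n<1+n n) n<j) _)
                     (spectrum-vanishes (single (contraction Δ* e)) (ℕ.s<s⁻¹ n<j) _))
      (≡.cong₂ ℤ._-_ (spectrum-vanishes P* (ℕ.<-trans (ℕ.n<1+n n) n<j) x)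
                     (spectrum-vanishes P* (ℕ.<-trans (ℕ.n<1+n n) n<j) _))))

    -- Duality rewrites the left side through `Δ` in degree `k` minus one, where the recursion for
    -- `Δ` applies; duality then takes each term back to `Δ*`.
    recursion-below : SpectralRecursionAt Δ e → ∀ k j → k ℕ.+ j ≡ suc n → ∀ x → RecursionAt j x
    recursion-below recursion k j k+j≡n x = begin
      S Δ* j x
        ≡⟨ dual-spectrum dual k j k+j≡n x ⟩
      (t· S Δ) k x ℤ.+ κ (suc n) x ℤ.* (#faces Δ* j x ℤ.- (t· #faces Δ) k x)
        ≡⟨ ≡.cong₂ ℤ._+_ (t-recursion k) (≡.cong₂ ℤ._*_ (≡.sym (κ-suc n x))
             (≡.cong₂ ℤ._-_ (#faces-deletion-contraction Δ* e j x y) (t-#faces k))) ⟩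
      ((t· S (deletion Δ e)) k y ℤ.+ (t· t· S (contraction Δ e)) k y ℤ.+ ((t· S′) k x ℤ.- (t· S′) k y))
        ℤ.+ κ n y ℤ.* ((#faces (deletion Δ* e) j y ℤ.+ (t· #faces (contraction Δ* e)) j y)
                        ℤ.- ((t· #faces (deletion Δ e)) k y ℤ.+ (t· t· #faces (contraction Δ e)) k y))
        -- Each spectrum is grouped with the face numbers of its own dual pair: contraction of `Δ`
        -- with deletion of `Δ*`, and deletion of `Δ` with contraction of `Δ*`.
        ≡⟨ rearrange ((t· S (deletion Δ e)) k y) ((t· t· S (contraction Δ e)) k y) _ (κ n y)
             (#faces (deletion Δ* e) j y) ((t· #faces (contraction Δ* e)) j y)
             ((t· #faces (deletion Δ e)) k y) ((t· t· #faces (contraction Δ e)) k y) ⟩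
      ((t· t· S (contraction Δ e)) k y ℤ.+ κ n y ℤ.* (#faces (deletion Δ* e) j y ℤ.- (t· t· #faces (contraction Δ e)) k y))
        ℤ.+ ((t· S (deletion Δ e)) k y ℤ.+ κ n y ℤ.* ((t· #faces (contraction Δ* e)) j y ℤ.- (t· #faces (deletion Δ e)) k y))
        ℤ.+ ((t· S′) k x ℤ.- (t· S′) k y)
        ≡⟨ ≡.cong₂ ℤ._+_ (≡.cong₂ ℤ._+_ (dual-spectrum-t (contraction-dual dual e) k j k+j≡n y)
                                         (t-dual-spectrum (deletion-dual dual e) k j k+j≡n y))
                         (≡.cong₂ ℤ._-_ (link k j k+j≡n x) (link k j k+j≡n y)) ⟨
      S (deletion Δ* e) j y ℤ.+ (t· S (contraction Δ* e)) j y ℤ.+ (spectrumPolynomial P* j x ℤ.- spectrumPolynomial P* j y) ∎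
      where
      open ≡.≡-Reasoning
      y = x + - 1#
      S′ = spectrumPolynomial P
      link = t-complementary-spectrum (pair-complementary dual e)
      t-recursion : ∀ k → (t· S Δ) k x ≡
        (t· S (deletion Δ e)) k y ℤ.+ (t· t· S (contraction Δ e)) k y ℤ.+ ((t· S′) k x ℤ.- (t· S′) k y)
      -- For `k` zero every term carries a factor t, and all coefficients are zero.
      t-recursion zero    = ≡.refl
      t-recursion (suc k) = recursion k x
      t-#faces : ∀ k → (t· #faces Δ) k x ≡ (t· #faces (deletion Δ e)) k y ℤ.+ (t· t· #faces (contraction Δ e)) k y
      t-#faces zero    = ≡.refl
      t-#faces (suc k) = #faces-deletion-contraction Δ e k x y
      rearrange : ∀ a b p c f₁ f₂ g₁ g₂ →
        (a ℤ.+ b ℤ.+ p) ℤ.+ c ℤ.* ((f₁ ℤ.+ f₂) ℤ.- (g₁ ℤ.+ g₂)) ≡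
        (b ℤ.+ c ℤ.* (f₁ ℤ.- g₂)) ℤ.+ (a ℤ.+ c ℤ.* (f₂ ℤ.- g₁)) ℤ.+ p
      rearrange = solve-∀

    dual-recursion : SpectralRecursionAt Δ e → SpectralRecursionAt Δ* e
    dual-recursion recursion j x with j ℕ.≤? suc n
    ... | yes j≤n = recursion-below recursion (suc n ℕ.∸ j) j (ℕ.m∸n+n≡m j≤n) x
    ... | no j≰n  = recursion-above j (ℕ.≰⇒> j≰n) x

  dual-satisfies : {Δ Δ* : SimplicialComplex n} → Dual Δ Δ* →
                   SatisfiesSpectralRecursion Δ → SatisfiesSpectralRecursion Δ*
  dual-satisfies {zero}  dual _         = _
  dual-satisfies {suc n} dual recursion e = dual-recursion dual e (recursion e)

-- The Alexander dual and the equivalence.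

^∨-dual : ∀ {n} (Δ : SimplicialComplex n) → Dual Δ (Δ ^∨)
^∨-dual Δ .∉⇒∁∈ F F∉Δ = F , F∉Δ , ≡.refl
^∨-dual Δ .∁∈⇒∉ F (G , G∉Δ , ∁F≡∁G) F∈Δ = G∉Δ (≡.subst (Face Δ) F≡G F∈Δ)
  where
  F≡G : F ≡ G
  F≡G = ≡.trans (≡.sym (∁-involutive F)) (≡.trans (≡.cong ∁ ∁F≡∁G) (∁-involutive G))

corollary6p8 : (ℝ : RealNumbers) → let open Spectral ℝ in
    (n : ℕ) (Δ : SimplicialComplex n) → SatisfiesSpectralRecursion Δ ⇔ SatisfiesSpectralRecursion (Δ ^∨)
corollary6p8 ℝ n Δ = mk⇔ (dual-satisfies (^∨-dual Δ))
                         (dual-satisfies (Dual-sym (^∨-dual Δ)))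
  where open Duality ℝ
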